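{- There is a constant $C$ such that in the 2-offer 3-uniform semirandom model there exists a strategy with the following property: for $n$ divisible by $3$, the hypergraph $H_t$ obtained after $t = Cn$ rounds asymptotically almost surely (i.e., with probability tending to $1$ as $n\to\infty$) contains a perfect matching.
   Context: The $r$-offer $s$-uniform semirandom model: a player builds a sequence of $s$-uniform hypergraphs $H_0, H_1, H_2, \ldots$ on vertex set $[n]=\{1,\ldots,n\}$, with $H_0$ empty. In each round $t\ge 1$, a uniformly random set of $r$ vertices of $[n]$ is offered; the player, knowing the offered vertices and the entire history (including $H_{t-1}$), chooses $s-r$ further vertices, and the resulting $s$-set is added as a hyperedge to $H_{t-1}$ to form $H_t$. (The player may also ignore an offer, which still counts as a round; formally it adds an arbitrary hyperedge that is never used.) A strategy is a rule for these choices. A perfect matching in an $s$-uniform hypergraph on $[n]$ is a set of $n/s$ pairwise disjoint hyperedges covering $[n]$. -}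

module Defs where

open import Data.Nat using (ℕ; _^_)
open import Data.Nat.Combinatorics using (_C_)
open import Data.Fin using (Fin; _<_; _≟_)
open import Data.Product using (Σ; _×_; _,_; ∃)
open import Data.Vec using (Vec; []; _∷_)
open import Data.List using (List; []; _∷_; filter; length)
open import Data.List.Relation.Unary.All using (All)
open import Data.List.Relation.Unary.Unique.Propositional using (Unique)
open import Data.List.Membership.Propositional using (_∈_)
open import Data.Sum using (_⊎_)
open import Relation.Binary.PropositionalEquality using (_≡_; _≢_)
open import Relation.Nullary using (Dec)
open import Relation.Nullary.Decidable using (_⊎-dec_)

-- An offer: a 2-element set {i , j} of vertices, represented as i < j.
Offer : ℕ → Set
Offer n = Σ (Fin n × Fin n) (λ p → Data.Product.proj₁ p < Data.Product.proj₂ p)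
  where import Data.Product

-- A (candidate) hyperedge: the two offered vertices and the chosen one.
Edge : ℕ → Set
Edge n = Fin n × Fin n × Fin n

-- An edge is a genuine 3-set iff its three vertices are pairwise distinct.
-- (If the player picks an offered vertex, the "edge" is not a 3-set and is
-- never usable: this models ignoring the offer.)
Proper : ∀ {n} → Edge n → Set
Proper (a , b , c) = a ≢ b × a ≢ c × b ≢ c

-- Deterministic strategy: given the history of previous offers (most recent
-- first; the player's own earlier choices are determined by it) and the
-- current offer, choose the third vertex.
Strategy : ℕ → Set
Strategy n = List (Offer n) → Offer n → Fin n

play : ∀ {n T} → Strategy n → List (Offer n) → Vec (Offer n) T → List (Edge n)
play σ hist [] = []
play σ hist (o@((i , j) , _) ∷ os) = (i , j , σ hist o) ∷ play σ (o ∷ hist) os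

hypergraph : ∀ {n T} → Strategy n → Vec (Offer n) T → List (Edge n)
hypergraph σ os = play σ [] os

_∈ₑ_ : ∀ {n} → Fin n → Edge n → Set
v ∈ₑ (a , b , c) = v ≡ a ⊎ v ≡ b ⊎ v ≡ c

_∈ₑ?_ : ∀ {n} (v : Fin n) (e : Edge n) → Dec (v ∈ₑ e)
v ∈ₑ? (a , b , c) = (v ≟ a) ⊎-dec ((v ≟ b) ⊎-dec (v ≟ c))

degree : ∀ {n} → Fin n → List (Edge n) → ℕ
degree v M = length (filter (v ∈ₑ?_) M)

HasPerfectMatching : ∀ {n} → List (Edge n) → Set
HasPerfectMatching {n} H =
  ∃ λ (M : List (Edge n)) →
    All (_∈ H) M × All Proper M × (∀ (v : Fin n) → degree v M ≡ 1)

-- Number of equally likely offer sequences of length T: each round offers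
-- a uniformly random 2-subset of [n], independently.
totalSequences : ℕ → ℕ → ℕ
totalSequences n T = (n C 2) ^ T

-- "At least g of the (equally likely) offer sequences of length T make H_T
-- contain a perfect matching", i.e. P(H_T has a PM) ≥ g / totalSequences n T.
AtLeastGood : (n T : ℕ) → Strategy n → ℕ → Set
AtLeastGood n T σ g =
  ∃ λ (L : List (Vec (Offer n) T)) →
    Unique L × All (λ os → HasPerfectMatching (hypergraph σ os)) L
    × g Data.Nat.≤ length L
  where import Data.Nat

{-# OPTIONS --safe #-}
-- Split [n] into X, Y and a copy Z of X, with x paired to π x ∈ Z.  In the first phase an
-- offer {x , y} with x ∈ X and y ∈ Y is completed by π x, so that matching x to y in the
-- resulting random bipartite graph covers three vertices.  With overwhelming probability
-- this graph is joined: any S ⊆ X and T ⊆ Y of size at least s = Θ(n) span an edge.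
-- Joinedness alone allows one to delete fewer than s vertices on each side (greedily, as
-- long as some small set violates Hall's condition) so that afterwards Hall's condition
-- holds for all small sets, where for sets S ⊆ X only neighbours in Y₀ = Y ∖ P count.
-- The deleted vertices x, π x and y, together with some fillers from P, are the targets
-- of the second phase: each is the third vertex of an edge whose offered pair lies in the
-- reserved set P, which succeeds with constant probability per round.  Since |P| shrinks
-- by a known amount, X and Y end up balanced, and Hall's theorem applies: small sets are
-- handled by the deletion step, large ones by joinedness and the complement in Y.

module Submission where

open import Defs
open import Data.Bool using (Bool; true; false; _∧_; _∨_; not; if_then_else_)
open import Data.Bool.ListAction using (any; all)
import Data.Bool.Properties as Boolₚ
open import Data.Empty using (⊥; ⊥-elim)
open import Data.Fin using (Fin; zero; suc; toℕ; fromℕ<)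
import Data.Fin as Fin
open import Data.Fin.Properties using (all?; toℕ-fromℕ<; toℕ-injective; toℕ<n)
open import Data.Fin.Subset.Properties using (anySubset?)
open import Data.List as List using (List; []; _∷_; _++_; map; length; filter; cartesianProductWith)
open import Data.List.Membership.Propositional using (_∈_)
open import Data.List.Membership.Propositional.Properties
  using (∈-map⁺; ∈-map⁻; ∈-tabulate⁻; ∈-++⁺ˡ; ∈-++⁺ʳ; ∈-cartesianProductWith⁺)
open import Data.List.Properties using (length-++; length-map; length-tabulate; ++-assoc; ++-identityʳ)
open import Data.List.Relation.Unary.All as All using (All; []; _∷_)
import Data.List.Relation.Unary.All.Properties as Allₚ
open import Data.List.Relation.Unary.AllPairs using ([]; _∷_)
open import Data.List.Relation.Unary.Any using (here; there)
open import Data.List.Relation.Unary.Unique.Propositional using (Unique)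
import Data.List.Relation.Unary.Unique.Propositional.Properties as Uniqueₚ
open import Data.Nat using (ℕ; zero; suc; _+_; _*_; _∸_; _^_; _≤_; _<_; z≤n; s≤s; _≤?_; _<?_; _<ᵇ_; NonZero)
import Data.Nat.Combinatorics as Comb
open import Data.Nat.Divisibility using (_∣_; divides; _∣?_)
open import Data.Nat.DivMod using (_/_; _%_; m≡m%n+[m/n]*n; m%n<n)
open import Data.Nat.Properties
open import Algebra.Properties.Semiring.Sum +-*-semiring
  using (sum; ∑-distrib-+; sum-cong-≗; *-distribˡ-sum; *-distribʳ-sum)
open import Data.Nat.Tactic.RingSolver using (solve-∀)
open import Data.Product using (∃; Σ; _×_; _,_; proj₁; proj₂)
open import Data.Sum using (_⊎_; inj₁; inj₂; [_,_]′)
open import Data.Vec as Vec using (Vec; []; _∷_; lookup; tabulate; toList; take; drop)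
open import Data.Vec.Properties using (lookup∘tabulate; ∷-injective; take++drop≡id)
open import Function using (_∘_)
open import Function.Bundles using (Equivalence)
open import Relation.Binary.PropositionalEquality
open import Relation.Nullary using (Dec; yes; no; does; ¬_; contradiction)
open import Relation.Nullary.Decidable using (_×-dec_; _→-dec_; dec-true; dec-false)

-- The offers decide which vertices of `P` the second phase uses up; only their number is known in
-- advance. So subsets of `X` must expand inside `Y₀`, which contains no pool vertex, and the final
-- matching then exists whichever part of `P` survives. The fillers fix
-- `size B + size C + size F = 2 * s`, which makes the balance independent of the size of `C`.
--
-- Probabilities are counts of offer sequences with all denominators cleared. Let N be the number of
-- offers. In the first phase, a round misses a fixed pair of sets of size at least s with
-- probability at most 1 - s²/N. In the second, a round succeeds with probability at least s²/(2N),
-- so a potential that doubles with each open target shrinks on average by the factor 1 - s²/(4N) =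
-- R/(4N). This weaker factor serves both phases. As s is linear in n, a suitable multiple of n
-- rounds brings its power below 4^(-n). That beats both the 2^n coded pairs of sets and the initial
-- potential, also at most 2^n, and leaves a failure probability of at most 2 · 2^(-n).

χ : Bool → ℕ
χ true = 1
χ false = 0

χ-mono : ∀ {a b} → (a ≡ true → b ≡ true) → χ a ≤ χ b
χ-mono {false} h = z≤n
χ-mono {true} {true} h = ≤-refl
χ-mono {true} {false} h = contradiction (h refl) λ ()

χ-∧ : ∀ a b → χ (a ∧ b) ≡ χ a * χ b
χ-∧ true b = sym (+-identityʳ (χ b))
χ-∧ false b = refl

sum-mono : ∀ {n} (f g : Fin n → ℕ) → (∀ i → f i ≤ g i) → sum f ≤ sum g
sum-mono {zero} f g h = z≤n
sum-mono {suc n} f g h = +-mono-≤ (h zero) (sum-mono _ _ (h ∘ suc))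

-- A gap at one index could not be made up at another. Later this turns an injective matching
-- between sets of equal size into a perfect one.
sum-antisym : ∀ {n} (f g : Fin n → ℕ) → (∀ i → f i ≤ g i) → sum g ≤ sum f → ∀ i → f i ≡ g i
sum-antisym {suc n} f g h e zero = ≤-antisym (h zero)
  (+-cancelʳ-≤ (sum (f ∘ suc)) (g zero) (f zero) (≤-trans (+-monoʳ-≤ (g zero) (sum-mono _ _ (h ∘ suc))) e))
sum-antisym {suc n} f g h e (suc i) = sum-antisym (f ∘ suc) (g ∘ suc) (h ∘ suc)
  (+-cancelˡ-≤ (f zero) _ _ (≤-trans (+-monoˡ-≤ (sum (g ∘ suc)) (h zero)) e)) i

-- Subsets as Boolean functions, and their sizes

Sub : ℕ → Set
Sub n = Fin n → Bool

size : ∀ {n} → Sub n → ℕ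
size S = sum (χ ∘ S)

infix 4 _⊆_
_⊆_ : ∀ {n} → Sub n → Sub n → Set
S ⊆ T = ∀ v → S v ≡ true → T v ≡ true

infixl 7 _∩_ _∖_
infixl 6 _∪_
_∩_ _∪_ _∖_ : ∀ {n} → Sub n → Sub n → Sub n
(S ∩ T) v = S v ∧ T v
(S ∪ T) v = S v ∨ T v
(S ∖ T) v = S v ∧ not (T v)

∅ : ∀ {n} → Sub n
∅ v = false

⁅_⁆ : ∀ {n} → Fin n → Sub n
⁅ u ⁆ v = does (v Fin.≟ u)

size-mono : ∀ {n} {S T : Sub n} → S ⊆ T → size S ≤ size T
size-mono h = sum-mono _ _ λ v → χ-mono (h v)

size-≤+ : ∀ {n} (S T U : Sub n) → (∀ v → χ (S v) ≤ χ (T v) + χ (U v)) → size S ≤ size T + size U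
size-≤+ S T U h = ≤-trans (sum-mono _ _ h) (≤-reflexive (∑-distrib-+ (χ ∘ T) (χ ∘ U)))

size-+ : ∀ {n} (S T U : Sub n) → (∀ v → χ (S v) ≡ χ (T v) + χ (U v)) → size S ≡ size T + size U
size-+ S T U h = trans (sum-cong-≗ h) (∑-distrib-+ (χ ∘ T) (χ ∘ U))

size-∅ : ∀ n → size {n} ∅ ≡ 0
size-∅ zero = refl
size-∅ (suc n) = size-∅ n

size-full : ∀ n → size {n} (λ _ → true) ≡ n
size-full zero = refl
size-full (suc n) = cong suc (size-full n)

size-⁅⁆ : ∀ {n} (u : Fin n) → size ⁅ u ⁆ ≡ 1
size-⁅⁆ {suc n} zero = cong suc (size-∅ n)
size-⁅⁆ {suc n} (suc u) = size-⁅⁆ u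

⁅⁆-self : ∀ {n} (u : Fin n) → ⁅ u ⁆ u ≡ true
⁅⁆-self u = dec-true (u Fin.≟ u) refl

⁅⁆⁻ : ∀ {n} {u v : Fin n} → ⁅ u ⁆ v ≡ true → v ≡ u
⁅⁆⁻ {u = u} {v} h with v Fin.≟ u
... | yes e = e

size-0⇒ : ∀ {n} (S : Sub n) → size S ≡ 0 → ∀ v → S v ≡ false
size-0⇒ {suc n} S e v with S zero in eq
size-0⇒ {suc n} S e zero | false = eq
size-0⇒ {suc n} S e (suc v) | false = size-0⇒ (S ∘ suc) e v

pick : ∀ {n} (S : Sub n) → 0 < size S → ∃ λ v → S v ≡ true
pick {suc n} S p with S zero in eq
... | true = zero , eq
... | false with pick (S ∘ suc) p
... | v , e = suc v , e

size-pos : ∀ {n} (S : Sub n) {v} → S v ≡ true → 0 < size S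
size-pos S {v} h with size S in eq
... | suc k = s≤s z≤n
... | zero with () ← trans (sym h) (size-0⇒ S eq v)

choose : ∀ {n} (S : Sub n) k → k ≤ size S → ∃ λ F → F ⊆ S × size F ≡ k
choose {n} S zero _ = ∅ , (λ v ()) , size-∅ n
choose {suc n} S (suc k) p with S zero in eq
... | true with choose (S ∘ suc) k (≤-pred p)
... | F , F⊆ , e = (λ { zero → true ; (suc v) → F v }) , (λ { zero _ → eq ; (suc v) h → F⊆ v h }) , cong suc e
choose {suc n} S (suc k) p | false with choose (S ∘ suc) (suc k) p
... | F , F⊆ , e = (λ { zero → false ; (suc v) → F v }) , (λ { zero () ; (suc v) h → F⊆ v h }) , e

_⊆?_ : ∀ {n} (S T : Sub n) → Dec (S ⊆ T)
S ⊆? T = all? λ v → (S v Boolₚ.≟ true) →-dec (T v Boolₚ.≟ true)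

-- The finite search runs over vectors. A subset is a function and agrees with its tabulation only
-- pointwise, so `resp` has to carry the property across.
search : ∀ {n} {P : Sub n → Set} → (∀ S → Dec (P S)) → (∀ {S T} → S ≗ T → P S → P T) → Dec (∃ P)
search P? resp with anySubset? (λ c → P? (lookup c))
... | yes (c , p) = yes (lookup c , p)
... | no ¬p = no λ { (S , p) → ¬p (tabulate S , resp (λ v → sym (lookup∘tabulate S v)) p) }

-- Sums over lists

ΣL : ∀ {A : Set} → List A → (A → ℕ) → ℕ
ΣL [] f = 0
ΣL (x ∷ xs) f = f x + ΣL xs f

module _ {A : Set} where

  ΣL-++ : ∀ (xs ys : List A) (f : A → ℕ) → ΣL (xs ++ ys) f ≡ ΣL xs f + ΣL ys f
  ΣL-++ [] ys f = refl
  ΣL-++ (x ∷ xs) ys f = trans (cong (f x +_) (ΣL-++ xs ys f)) (sym (+-assoc (f x) _ _))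

  ΣL-mono : ∀ (xs : List A) {f g : A → ℕ} → (∀ x → f x ≤ g x) → ΣL xs f ≤ ΣL xs g
  ΣL-mono [] h = z≤n
  ΣL-mono (x ∷ xs) h = +-mono-≤ (h x) (ΣL-mono xs h)

  ΣL-cong : ∀ (xs : List A) {f g : A → ℕ} → (∀ x → f x ≡ g x) → ΣL xs f ≡ ΣL xs g
  ΣL-cong [] h = refl
  ΣL-cong (x ∷ xs) h = cong₂ _+_ (h x) (ΣL-cong xs h)

  ΣL-const : ∀ (xs : List A) c → ΣL xs (λ _ → c) ≡ length xs * c
  ΣL-const [] c = refl
  ΣL-const (x ∷ xs) c = cong (c +_) (ΣL-const xs c)

  ΣL-+ : ∀ (xs : List A) (f g : A → ℕ) → ΣL xs (λ x → f x + g x) ≡ ΣL xs f + ΣL xs g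
  ΣL-+ [] f g = refl
  ΣL-+ (x ∷ xs) f g = trans (cong (f x + g x +_) (ΣL-+ xs f g)) (interchange (f x) (g x) _ _)
    where
    interchange : ∀ a b c d → (a + b) + (c + d) ≡ (a + c) + (b + d)
    interchange = solve-∀

  ΣL-*ʳ : ∀ (xs : List A) (f : A → ℕ) c → ΣL xs f * c ≡ ΣL xs (λ x → f x * c)
  ΣL-*ʳ [] f c = refl
  ΣL-*ʳ (x ∷ xs) f c = trans (*-distribʳ-+ c (f x) _) (cong (f x * c +_) (ΣL-*ʳ xs f c))

  ΣL-bound : ∀ (xs : List A) (f : A → ℕ) c → (∀ x → f x ≤ c) → ΣL xs f ≤ length xs * c
  ΣL-bound xs f c h = ≤-trans (ΣL-mono xs h) (≤-reflexive (ΣL-const xs c))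

ΣL-map : ∀ {A B : Set} (g : A → B) (xs : List A) (f : B → ℕ) → ΣL (map g xs) f ≡ ΣL xs (f ∘ g)
ΣL-map g [] f = refl
ΣL-map g (x ∷ xs) f = cong (f (g x) +_) (ΣL-map g xs f)

ΣL-swap : ∀ {A B : Set} (xs : List A) (ys : List B) (f : A → B → ℕ) →
  ΣL xs (λ x → ΣL ys (f x)) ≡ ΣL ys (λ y → ΣL xs (λ x → f x y))
ΣL-swap [] ys f = sym (trans (ΣL-const ys 0) (*-zeroʳ (length ys)))
ΣL-swap (x ∷ xs) ys f = trans (cong (ΣL ys (f x) +_) (ΣL-swap xs ys f)) (sym (ΣL-+ ys (f x) _))

ΣL-sum-swap : ∀ {A : Set} {n} (xs : List A) (f : A → Fin n → ℕ) →
  sum (λ v → ΣL xs (λ x → f x v)) ≡ ΣL xs (λ x → sum (f x))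
ΣL-sum-swap {n = zero} xs f = sym (trans (ΣL-const xs 0) (*-zeroʳ (length xs)))
ΣL-sum-swap {n = suc n} xs f = trans (cong (ΣL xs (λ x → f x zero) +_) (ΣL-sum-swap xs (λ x → f x ∘ suc))) (sym (ΣL-+ xs _ _))

ΣL-product : ∀ {A B C : Set} (g : A → B → C) (xs : List A) (ys : List B) (f : C → ℕ) →
  ΣL (cartesianProductWith g xs ys) f ≡ ΣL xs (λ x → ΣL ys (λ y → f (g x y)))
ΣL-product g [] ys f = refl
ΣL-product g (x ∷ xs) ys f = trans (ΣL-++ (map (g x) ys) _ f) (cong₂ _+_ (ΣL-map (g x) ys f) (ΣL-product g xs ys f))

ΣL-length : ∀ {A : Set} (xs : List A) → ΣL xs (λ _ → 1) ≡ length xs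
ΣL-length xs = trans (ΣL-const xs 1) (*-identityʳ (length xs))

∧⁺ : ∀ {a b} → a ≡ true → b ≡ true → a ∧ b ≡ true
∧⁺ refl refl = refl

∧⁻ : ∀ {a b} → a ∧ b ≡ true → a ≡ true × b ≡ true
∧⁻ {true} {true} h = refl , refl

∨⁻ : ∀ {a b} → a ∨ b ≡ true → a ≡ true ⊎ b ≡ true
∨⁻ {true} h = inj₁ refl
∨⁻ {false} h = inj₂ h

∨⁺ˡ : ∀ {a b} → a ≡ true → a ∨ b ≡ true
∨⁺ˡ refl = refl

∨⁺ʳ : ∀ {a b} → b ≡ true → a ∨ b ≡ true
∨⁺ʳ {true} refl = refl
∨⁺ʳ {false} refl = refl

not⁻ : ∀ {b} → not b ≡ true → b ≢ true
not⁻ {false} _ ()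

not⁺ : ∀ {b} → b ≢ true → not b ≡ true
not⁺ {false} _ = refl
not⁺ {true} h = contradiction refl h

χ-∖ : ∀ {a b} → (b ≡ true → a ≡ true) → χ a ≡ χ b + χ (a ∧ not b)
χ-∖ {true} {true} h = refl
χ-∖ {true} {false} h = refl
χ-∖ {false} {true} h with () ← h refl
χ-∖ {false} {false} h = refl

χ-∩∖ : ∀ a b → χ (b ∧ a) + χ (a ∧ not b) ≡ χ a
χ-∩∖ true true = refl
χ-∩∖ true false = refl
χ-∩∖ false true = refl
χ-∩∖ false false = refl

χ-⊎ : ∀ {a b} → (a ≡ true → b ≢ true) → χ (a ∨ b) ≡ χ a + χ b
χ-⊎ {true} {true} h = contradiction refl (h refl)
χ-⊎ {true} {false} h = refl
χ-⊎ {false} h = refl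

χ-∨≤ : ∀ a b → χ (a ∨ b) ≤ χ a + χ b
χ-∨≤ true b = s≤s z≤n
χ-∨≤ false b = ≤-refl

module _ {n : ℕ} where

  size-∖ : ∀ {S A : Sub n} → S ⊆ A → size A ≡ size S + size (A ∖ S)
  size-∖ {S} {A} h = size-+ A S (A ∖ S) λ v → χ-∖ (h v)

  size-∩∖ : ∀ (A S : Sub n) → size A ≡ size (S ∩ A) + size (A ∖ S)
  size-∩∖ A S = size-+ A (S ∩ A) (A ∖ S) λ v → sym (χ-∩∖ (A v) (S v))

  size-∖≥ : ∀ (A S : Sub n) → size A ≤ size S + size (A ∖ S)
  size-∖≥ A S = ≤-trans (≤-reflexive (size-∩∖ A S)) (+-monoˡ-≤ _ (size-mono {S = S ∩ A} {S} λ v → proj₁ ∘ ∧⁻))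

  size-⊎ : ∀ (S T : Sub n) → (∀ v → S v ≡ true → T v ≢ true) → size (S ∪ T) ≡ size S + size T
  size-⊎ S T h = size-+ (S ∪ T) S T λ v → χ-⊎ (h v)

  size-cong : ∀ {S T : Sub n} → S ≗ T → size S ≡ size T
  size-cong e = sum-cong-≗ (λ v → cong χ (e v))

  ⊆-trans : {S T U : Sub n} → S ⊆ T → T ⊆ U → S ⊆ U
  ⊆-trans p q v h = q v (p v h)

  ∖-⊆ : (S T : Sub n) → S ∖ T ⊆ S
  ∖-⊆ S T v = proj₁ ∘ ∧⁻

  ≗⇒⊆ : {S T : Sub n} → S ≗ T → S ⊆ T
  ≗⇒⊆ e v h = trans (sym (e v)) h

<ᵇ⁺ : ∀ {a b} → a < b → (a <ᵇ b) ≡ true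
<ᵇ⁺ p = Equivalence.to Boolₚ.T-≡ (<⇒<ᵇ p)

<ᵇ⁻ : ∀ {a b} → (a <ᵇ b) ≡ true → a < b
<ᵇ⁻ {a} {b} p = <ᵇ⇒< a b (Equivalence.from Boolₚ.T-≡ p)

-- Neighbourhoods, matchings and Hall's theorem

δ : ∀ {n} → Fin n → Fin n → ℕ
δ v x = χ (⁅ x ⁆ v)

module Graph {n : ℕ} (adj : Fin n → Fin n → Bool) where

  N : Sub n → Sub n
  N S v = 0 <ᵇ size (λ u → S u ∧ adj u v)

  N⁺ : ∀ (S : Sub n) {u v} → S u ≡ true → adj u v ≡ true → N S v ≡ true
  N⁺ S {u} {v} p q = <ᵇ⁺ (size-pos (λ w → S w ∧ adj w v) (∧⁺ p q))

  N⁻ : ∀ (S : Sub n) {v} → N S v ≡ true → ∃ λ u → S u ≡ true × adj u v ≡ true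
  N⁻ S {v} h with pick (λ w → S w ∧ adj w v) (<ᵇ⁻ {0} h)
  ... | u , p = u , ∧⁻ p

  N-mono : ∀ {S T} → S ⊆ T → N S ⊆ N T
  N-mono {S} {T} h v p with N⁻ S p
  ... | u , a , b = N⁺ T (h u a) b

  N-∪ : ∀ S T {v} → N (S ∪ T) v ≡ true → N S v ≡ true ⊎ N T v ≡ true
  N-∪ S T p with N⁻ (S ∪ T) p
  ... | u , a , b with ∨⁻ a
  ... | inj₁ c = inj₁ (N⁺ S c b)
  ... | inj₂ c = inj₂ (N⁺ T c b)

  -- Both sides are described by multiplicities: left ends hit `A` exactly once, right ends hit `B`
  -- at most once. Matchings can then be concatenated by adding sums, with no disjointness proofs to
  -- carry.
  record Matching (A B : Sub n) : Set where
    field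
      pairs : List (Fin n × Fin n)
      edges : All (λ p → A (proj₁ p) ≡ true × B (proj₂ p) ≡ true × adj (proj₁ p) (proj₂ p) ≡ true) pairs
      left  : ∀ v → ΣL pairs (δ v ∘ proj₁) ≡ χ (A v)
      right : ∀ v → ΣL pairs (δ v ∘ proj₂) ≤ χ (B v)

  open Matching

  HallCondition : Sub n → Sub n → Set
  HallCondition A B = ∀ S → S ⊆ A → size S ≤ size (N S ∩ B)

  Expands : ℕ → Sub n → Sub n → Set
  Expands s A B = ∀ S → S ⊆ A → size S ≤ s → size S ≤ size (N S ∩ B)

  N∩-cong : ∀ {S T} B → S ≗ T → size (N S ∩ B) ≡ size (N T ∩ B)
  N∩-cong {S} {T} B e = size-cong λ v → cong (λ k → (0 <ᵇ k) ∧ B v)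
    (size-cong {S = λ u → S u ∧ adj u v} {λ u → T u ∧ adj u v} λ u → cong (_∧ adj u v) (e u))

  N∩-mono : ∀ S {B C} → B ⊆ C → size (N S ∩ B) ≤ size (N S ∩ C)
  N∩-mono S {B} {C} h = size-mono {S = N S ∩ B} {N S ∩ C} λ v p → let a , b = ∧⁻ p in ∧⁺ a (h v b)

  -- A neighbour of the union is charged to `T` if `T` reaches it, and to `S` only otherwise.
  N∩-∪ : ∀ S T B C → B ⊆ C → size (N (S ∪ T) ∩ B) ≤ size (N S ∩ (B ∖ N T)) + size (N T ∩ C)
  N∩-∪ S T B C B⊆C = size-≤+ (N (S ∪ T) ∩ B) (N S ∩ (B ∖ N T)) (N T ∩ C) λ v → pointwise v
    where
    pointwise : ∀ v → χ ((N (S ∪ T) ∩ B) v) ≤ χ ((N S ∩ (B ∖ N T)) v) + χ ((N T ∩ C) v)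
    pointwise v = ≤-trans (χ-mono {b = (N S ∩ (B ∖ N T)) v ∨ (N T ∩ C) v} step) (χ-∨≤ ((N S ∩ (B ∖ N T)) v) _)
      where
      step : (N (S ∪ T) ∩ B) v ≡ true → (N S ∩ (B ∖ N T)) v ∨ (N T ∩ C) v ≡ true
      step h with ∧⁻ h
      ... | a , b with N T v in eq
      ... | true = ∨⁺ʳ {N S v ∧ (B v ∧ false)} (B⊆C v b)
      ... | false with N-∪ S T a
      ... | inj₁ c = ∨⁺ˡ (∧⁺ c (∧⁺ b refl))
      ... | inj₂ c with () ← trans (sym eq) c

  empty-matching : ∀ A B → size A ≡ 0 → Matching A B
  empty-matching A B e .pairs = []
  empty-matching A B e .edges = []
  empty-matching A B e .left v = sym (cong χ (size-0⇒ A e v))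
  empty-matching A B e .right v = z≤n

  -- Under Hall's condition the last inequality is an equality. The two strict inequalities make
  -- both halves of the split smaller than `A`.
  Tight : Sub n → Sub n → Sub n → Set
  Tight A B S = S ⊆ A × 0 < size S × size S < size A × size (N S ∩ B) ≤ size S

  tight? : ∀ A B → Dec (∃ (Tight A B))
  tight? A B = search
    (λ S → (S ⊆? A) ×-dec (0 <? size S) ×-dec (size S <? size A) ×-dec (size (N S ∩ B) ≤? size S))
    λ {S} {T} e (p , q , r , t) →
      ⊆-trans {S = T} {S} {A} (≗⇒⊆ (sym ∘ e)) p , subst (0 <_) (size-cong e) q ,
      subst (_< size A) (size-cong e) r , subst₂ _≤_ (N∩-cong B e) (size-cong e) t

  -- Halmos–Vaughan: split along a tight set if there is one, otherwise any edge may be removed.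
  hall : ∀ f A B → size A ≤ f → HallCondition A B → Matching A B
  hall zero A B A≤f hc = empty-matching A B (n≤0⇒n≡0 A≤f)
  hall (suc f) A B A≤f hc with size A ≟ 0
  ... | yes e = empty-matching A B e
  ... | no A≢0 with tight? A B
  ... | yes (S , S⊆A , 0<S , S<A , t) = result
    where
    A≡ = size-∖ {S = S} {A} S⊆A

    M₁ : Matching S (N S ∩ B)
    M₁ = hall f S (N S ∩ B) (≤-pred (≤-trans S<A A≤f)) λ S′ S′⊆S →
      ≤-trans (hc S′ (⊆-trans {S = S′} {S} {A} S′⊆S S⊆A))
        (size-mono {S = N S′ ∩ B} {N S′ ∩ (N S ∩ B)} λ v h → let a , b = ∧⁻ h in ∧⁺ a (∧⁺ (N-mono {S′} {S} S′⊆S v a) b))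

    cond : HallCondition (A ∖ S) (B ∖ N S)
    -- Hall's condition is applied to `S′` enlarged by the tight set: `S` accounts for no more than
    -- its own size in neighbours, so those missed by `S` suffice for `S′`.
    cond S′ h = +-cancelʳ-≤ (size S) _ _ (begin
      size S′ + size S ≡⟨ sym (size-⊎ S′ S λ v p → not⁻ (proj₂ (∧⁻ {A v} (h v p)))) ⟩
      size (S′ ∪ S) ≤⟨ hc (S′ ∪ S) (λ v p → [ (λ q → proj₁ (∧⁻ (h v q))) , S⊆A v ]′ (∨⁻ p)) ⟩
      size (N (S′ ∪ S) ∩ B) ≤⟨ N∩-∪ S′ S B B (λ v p → p) ⟩
      size (N S′ ∩ (B ∖ N S)) + size (N S ∩ B) ≤⟨ +-monoʳ-≤ _ t ⟩
      size (N S′ ∩ (B ∖ N S)) + size S ∎)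
      where open ≤-Reasoning

    M₂ : Matching (A ∖ S) (B ∖ N S)
    M₂ = hall f (A ∖ S) (B ∖ N S)
      (≤-pred (≤-trans (+-monoˡ-≤ (size (A ∖ S)) 0<S) (≤-trans (≤-reflexive (sym A≡)) A≤f))) cond

    result : Matching A B
    result .pairs = pairs M₁ ++ pairs M₂
    result .edges = Allₚ.++⁺
      (All.map (λ (a , b , c) → S⊆A _ a , proj₂ (∧⁻ b) , c) (edges M₁))
      (All.map (λ (a , b , c) → proj₁ (∧⁻ a) , proj₁ (∧⁻ b) , c) (edges M₂))
    result .left v = trans (ΣL-++ (pairs M₁) (pairs M₂) _)
      (trans (cong₂ _+_ (left M₁ v) (left M₂ v)) (sym (χ-∖ (S⊆A v))))
    result .right v = ≤-trans (≤-reflexive (ΣL-++ (pairs M₁) (pairs M₂) _))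
      (≤-trans (+-mono-≤ (right M₁ v) (right M₂ v)) (≤-reflexive (χ-∩∖ (B v) (N S v))))
  ... | no loose = result
    where
    p₁ = pick A (n≢0⇒n>0 A≢0)
    x = proj₁ p₁
    x⊆A : ⁅ x ⁆ ⊆ A
    x⊆A v h = subst (λ w → A w ≡ true) (sym (⁅⁆⁻ h)) (proj₂ p₁)
    p₂ = pick (N ⁅ x ⁆ ∩ B) (≤-trans (≤-reflexive (sym (size-⁅⁆ x))) (hc ⁅ x ⁆ x⊆A))
    y = proj₁ p₂
    y∈B = proj₂ (∧⁻ {N ⁅ x ⁆ y} (proj₂ p₂))
    y⊆B : ⁅ y ⁆ ⊆ B
    y⊆B v h = subst (λ w → B w ≡ true) (sym (⁅⁆⁻ h)) y∈B
    x~y : adj x y ≡ true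
    x~y with N⁻ ⁅ x ⁆ (proj₁ (∧⁻ (proj₂ p₂)))
    ... | u , a , b = subst (λ w → adj w y ≡ true) (⁅⁆⁻ a) b

    A≡ : size A ≡ suc (size (A ∖ ⁅ x ⁆))
    A≡ = trans (size-∖ {S = ⁅ x ⁆} {A} x⊆A) (cong (_+ size (A ∖ ⁅ x ⁆)) (size-⁅⁆ x))

    cond : HallCondition (A ∖ ⁅ x ⁆) (B ∖ ⁅ y ⁆)
    cond S S⊆ with size S ≟ 0
    ... | yes e = ≤-trans (≤-reflexive e) z≤n
    -- Without tight sets, every non-empty proper subset has a neighbour to spare, and this pays for
    -- the loss of `y`.
    ... | no S≢0 = ≤-pred (begin-strict
      size S <⟨ ≰⇒> (λ t → loose (S , ⊆-trans {S = S} {A ∖ ⁅ x ⁆} {A} S⊆ (∖-⊆ A ⁅ x ⁆) , n≢0⇒n>0 S≢0 ,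
        ≤-trans (s≤s (size-mono {S = S} S⊆)) (≤-reflexive (sym A≡)) , t)) ⟩
      size (N S ∩ B) ≤⟨ size-≤+ (N S ∩ B) ⁅ y ⁆ (N S ∩ (B ∖ ⁅ y ⁆)) (λ v → pointwise (N S v) (B v) (⁅ y ⁆ v)) ⟩
      size ⁅ y ⁆ + size (N S ∩ (B ∖ ⁅ y ⁆)) ≡⟨ cong (_+ size (N S ∩ (B ∖ ⁅ y ⁆))) (size-⁅⁆ y) ⟩
      suc (size (N S ∩ (B ∖ ⁅ y ⁆))) ∎)
      where
      open ≤-Reasoning
      pointwise : ∀ a b c → χ (a ∧ b) ≤ χ c + χ (a ∧ (b ∧ not c))
      pointwise false b c = z≤n
      pointwise true b c = ≤-trans (≤-reflexive (sym (χ-∩∖ b c))) (+-monoˡ-≤ (χ (b ∧ not c)) (χ-mono {c ∧ b} (proj₁ ∘ ∧⁻)))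

    M : Matching (A ∖ ⁅ x ⁆) (B ∖ ⁅ y ⁆)
    M = hall f (A ∖ ⁅ x ⁆) (B ∖ ⁅ y ⁆) (≤-pred (≤-trans (≤-reflexive (sym A≡)) A≤f)) cond

    result : Matching A B
    result .pairs = (x , y) ∷ pairs M
    result .edges = (proj₂ p₁ , y∈B , x~y) ∷ All.map (λ (a , b , c) → proj₁ (∧⁻ a) , proj₁ (∧⁻ b) , c) (edges M)
    result .left v = trans (cong (δ v x +_) (left M v)) (sym (χ-∖ (x⊆A v)))
    result .right v = ≤-trans (+-monoʳ-≤ (δ v y) (right M v)) (≤-reflexive (sym (χ-∖ (y⊆B v))))

  -- Joined graphs: deletion of badly expanding sets

  Joined : ℕ → Sub n → Sub n → Set
  Joined s X Y = ∀ S T → S ⊆ X → T ⊆ Y → s ≤ size S → s ≤ size T →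
    ∃ λ u → ∃ λ v → S u ≡ true × T v ≡ true × adj u v ≡ true

  -- The invariant of the deletion process: what has been deleted has few neighbours among what is
  -- left, and this is what keeps it small in a joined graph. The shape is symmetric, so that `swap`
  -- lets one growth step serve both sides.
  record Peeled (s : ℕ) (X X₀ Y Y₀ B C : Sub n) : Set where
    field
      B⊆X : B ⊆ X
      C⊆Y : C ⊆ Y
      B<s : size B < s
      C<s : size C < s
      N-B : size (N B ∩ (Y₀ ∖ C)) ≤ size B
      N-C : size (N C ∩ (X₀ ∖ B)) ≤ size C

  swap : ∀ {s X X₀ Y Y₀ B C} → Peeled s X X₀ Y Y₀ B C → Peeled s Y Y₀ X X₀ C B
  swap p = record { B⊆X = C⊆Y ; C⊆Y = B⊆X ; B<s = C<s ; C<s = B<s ; N-B = N-C ; N-C = N-B }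
    where open Peeled p

  Violates : ℕ → Sub n → Sub n → Sub n → Set
  Violates s A B S = S ⊆ A × size S ≤ s × size (N S ∩ B) < size S

  violator? : ∀ s A B → Dec (∃ (Violates s A B))
  violator? s A B = search
    (λ S → (S ⊆? A) ×-dec (size S ≤? s) ×-dec (size (N S ∩ B) <? size S))
    λ {S} {T} e (p , q , r) →
      ⊆-trans {S = T} {S} {A} (≗⇒⊆ (sym ∘ e)) p , subst (_≤ s) (size-cong e) q ,
      subst₂ _<_ (N∩-cong B e) (size-cong e) r

  expands : ∀ {s A B} → ¬ (∃ (Violates s A B)) → Expands s A B
  expands none S S⊆A S≤s = ≮⇒≥ λ lt → none (S , S⊆A , S≤s , lt)

  -- A set with as few neighbours as B ∪ S cannot reach size s: it would not be joined
  -- to the rest of Y₀.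
  grow : ∀ {s X X₀ Y Y₀ B C S} → Joined s X Y → Y₀ ⊆ Y → 4 * s ≤ size Y₀ →
    Peeled s X X₀ Y Y₀ B C → Violates s (X ∖ B) (Y₀ ∖ C) S →
    Peeled s X X₀ Y Y₀ (B ∪ S) C × size B < size (B ∪ S)
  grow {s} {X} {X₀} {Y} {Y₀} {B} {C} {S} joined Y₀⊆Y 4s≤ P (S⊆ , S≤s , few) =
    record { B⊆X = B∪S⊆X ; C⊆Y = C⊆Y ; B<s = small ; C<s = C<s ; N-B = fewN
           ; N-C = ≤-trans (N∩-mono C {X₀ ∖ (B ∪ S)} {X₀ ∖ B} shrink) N-C } ,
    subst (size B <_) (sym size-∪) (m<m+n (size B) (≤-trans (s≤s z≤n) few))
    where
    open Peeled P
    size-∪ : size (B ∪ S) ≡ size B + size S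
    size-∪ = size-⊎ B S λ v b s → not⁻ (proj₂ (∧⁻ {X v} (S⊆ v s))) b
    B∪S⊆X : B ∪ S ⊆ X
    B∪S⊆X v p = [ B⊆X v , (λ q → proj₁ (∧⁻ (S⊆ v q))) ]′ (∨⁻ p)
    shrink : X₀ ∖ (B ∪ S) ⊆ X₀ ∖ B
    shrink v h = let a , b = ∧⁻ {X₀ v} h in ∧⁺ a (not⁺ λ c → not⁻ b (∨⁺ˡ c))
    fewN : size (N (B ∪ S) ∩ (Y₀ ∖ C)) ≤ size (B ∪ S)
    fewN = begin
      size (N (B ∪ S) ∩ (Y₀ ∖ C)) ≤⟨ N∩-∪ B S (Y₀ ∖ C) (Y₀ ∖ C) (λ v p → p) ⟩
      size (N B ∩ ((Y₀ ∖ C) ∖ N S)) + size (N S ∩ (Y₀ ∖ C))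
        ≤⟨ +-mono-≤ (≤-trans (N∩-mono B {(Y₀ ∖ C) ∖ N S} {Y₀ ∖ C} (∖-⊆ (Y₀ ∖ C) (N S))) N-B) (<⇒≤ few) ⟩
      size B + size S ≡⟨ sym size-∪ ⟩
      size (B ∪ S) ∎
      where open ≤-Reasoning
    small : size (B ∪ S) < s
    small = ≰⇒> λ s≤ → unjoined s≤
      where
      T : Sub n
      T = (Y₀ ∖ C) ∖ N (B ∪ S)
      -- Of the `4 * s` vertices at most `s` lie in `C`, and at most `2 * s` are neighbours of
      -- `B ∪ S`, because `size B < s` and `size S ≤ s`.
      T≥s : s ≤ size T
      T≥s = +-cancelˡ-≤ (s + (s + s)) _ _ (begin
        s + (s + s) + s ≡⟨ trans (+-comm (s + (s + s)) s) (cong (λ k → s + (s + (s + k))) (sym (+-identityʳ s))) ⟩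
        4 * s ≤⟨ 4s≤ ⟩
        size Y₀ ≤⟨ size-∖≥ Y₀ C ⟩
        size C + size (Y₀ ∖ C) ≡⟨ cong (size C +_) (size-∩∖ (Y₀ ∖ C) (N (B ∪ S))) ⟩
        size C + (size (N (B ∪ S) ∩ (Y₀ ∖ C)) + size T) ≤⟨ +-mono-≤ (<⇒≤ C<s) (+-monoˡ-≤ (size T)
           (≤-trans fewN (≤-trans (≤-reflexive size-∪) (+-mono-≤ (<⇒≤ B<s) S≤s)))) ⟩
        s + (s + s + size T) ≡⟨ sym (+-assoc s (s + s) (size T)) ⟩
        s + (s + s) + size T ∎)
        where open ≤-Reasoning
      unjoined : s ≤ size (B ∪ S) → ⊥
      unjoined s≤ with joined (B ∪ S) T B∪S⊆X (λ v h → Y₀⊆Y v (proj₁ (∧⁻ (proj₁ (∧⁻ {Y₀ v ∧ not (C v)} h))))) s≤ T≥s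
      ... | u , v , a , b , c = not⁻ (proj₂ (∧⁻ {Y₀ v ∧ not (C v)} b)) (N⁺ (B ∪ S) a c)

  -- Each growth step raises `size B + size C`, which stays below `s + s`; the fuel `f` is the
  -- distance still allowed.
  peel : ∀ {s X X₀ Y Y₀} → Joined s X Y → Joined s Y X → X₀ ⊆ X → Y₀ ⊆ Y → 4 * s ≤ size X₀ → 4 * s ≤ size Y₀ →
    ∀ f B C → Peeled s X X₀ Y Y₀ B C → s + s ≤ size B + size C + f →
    ∃ λ B → ∃ λ C → Peeled s X X₀ Y Y₀ B C × Expands s (X ∖ B) (Y₀ ∖ C) × Expands s (Y ∖ C) (X₀ ∖ B)
  peel {s} jXY jYX X₀⊆ Y₀⊆ hX hY zero B C P bound =
    contradiction (≤-trans bound (≤-reflexive (+-identityʳ _))) (<⇒≱ (+-mono-< (Peeled.B<s P) (Peeled.C<s P)))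
  peel {s} {X} {X₀} {Y} {Y₀} jXY jYX X₀⊆ Y₀⊆ hX hY (suc f) B C P bound
    with violator? s (X ∖ B) (Y₀ ∖ C) | violator? s (Y ∖ C) (X₀ ∖ B)
  ... | yes (S , viol) | _ with grow jXY Y₀⊆ hY P viol
  ... | P′ , lt = peel jXY jYX X₀⊆ Y₀⊆ hX hY f (B ∪ S) C P′
    (≤-trans bound (≤-trans (≤-reflexive (+-suc (size B + size C) f)) (+-monoˡ-≤ f (+-monoˡ-≤ (size C) lt))))
  peel {s} {X} {X₀} {Y} {Y₀} jXY jYX X₀⊆ Y₀⊆ hX hY (suc f) B C P bound
    | no none | yes (S , viol) with grow jYX X₀⊆ hX (swap P) viol
  ... | P′ , lt = peel jXY jYX X₀⊆ Y₀⊆ hX hY f B (C ∪ S) (swap P′)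
    (≤-trans bound (≤-trans (≤-reflexive (+-suc (size B + size C) f)) (+-monoˡ-≤ f
      (≤-trans (≤-reflexive (sym (+-suc (size B) (size C)))) (+-monoʳ-≤ (size B) lt)))))
  peel jXY jYX X₀⊆ Y₀⊆ hX hY (suc f) B C P bound
    | no none | no none′ = B , C , P , expands none , expands none′

  -- If `S` is large, the part `T` of `Y′` that it misses is small by joinedness. So `T` expands
  -- into `A`, and its neighbours avoid `S`: `T` is no larger than the rest of `A`. As `A` and `Y′`
  -- have equal size, passing to complements gives Hall's condition for `S`. The set `Y′` is free
  -- between `Y₀` and `Y` without `C`, since the surviving pool is not known beforehand.
  match : (∀ u v → adj u v ≡ adj v u) → ∀ {s X Y A C Y₀ Y′} → Joined s X Y →
    A ⊆ X → Y₀ ⊆ Y′ → Y′ ⊆ Y ∖ C → size A ≡ size Y′ →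
    Expands s A Y₀ → Expands s (Y ∖ C) A → Matching A Y′
  match adj-sym {s} {X} {Y} {A} {C} {Y₀} {Y′} joined A⊆X Y₀⊆ Y′⊆ A≡Y′ expA expY = hall (size A) A Y′ ≤-refl cond
    where
    cond : HallCondition A Y′
    cond S S⊆A with size S ≤? s
    ... | yes S≤s = ≤-trans (expA S S⊆A S≤s) (N∩-mono S {Y₀} {Y′} Y₀⊆)
    ... | no S≰s = +-cancelʳ-≤ (size (A ∖ S)) _ _ (begin
      size S + size (A ∖ S) ≡⟨ sym (size-∖ {S = S} {A} S⊆A) ⟩
      size A ≡⟨ A≡Y′ ⟩
      size Y′ ≡⟨ size-∩∖ Y′ (N S) ⟩
      size (N S ∩ Y′) + size T ≤⟨ +-monoʳ-≤ _ (≤-trans (expY T T⊆ (<⇒≤ T<s)) (size-mono {S = N T ∩ A} {A ∖ S} avoid)) ⟩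
      size (N S ∩ Y′) + size (A ∖ S) ∎)
      where
      open ≤-Reasoning
      T : Sub n
      T = Y′ ∖ N S
      T⊆ : T ⊆ Y ∖ C
      T⊆ v h = Y′⊆ v (proj₁ (∧⁻ h))
      T<s : size T < s
      T<s = ≰⇒> λ s≤T → let u , v , a , b , c = joined S T (λ v h → A⊆X v (S⊆A v h))
                               (λ v h → proj₁ (∧⁻ (T⊆ v h))) (≰⇒≥ S≰s) s≤T
                        in not⁻ (proj₂ (∧⁻ {Y′ v} b)) (N⁺ S a c)
      avoid : N T ∩ A ⊆ A ∖ S
      avoid u h = let a , b = ∧⁻ {N T u} h ; v , c , d = N⁻ T a in
        ∧⁺ b (not⁺ λ e → not⁻ (proj₂ (∧⁻ {Y′ v} c)) (N⁺ S e (trans (adj-sym u v) d)))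

any⁻ : ∀ {A : Set} (p : A → Bool) xs → any p xs ≡ true → ∃ λ x → x ∈ xs × p x ≡ true
any⁻ p (x ∷ xs) h with p x in eq
... | true = x , here refl , eq
... | false with any⁻ p xs h
... | y , m , e = y , there m , e

any⁺ : ∀ {A : Set} (p : A → Bool) {x xs} → x ∈ xs → p x ≡ true → any p xs ≡ true
any⁺ p (here refl) h = ∨⁺ˡ h
any⁺ p {xs = y ∷ xs} (there m) h = ∨⁺ʳ {p y} (any⁺ p m h)

all-false⁻ : ∀ {A : Set} (p : A → Bool) xs → all p xs ≡ false → ∃ λ x → x ∈ xs × p x ≡ false
all-false⁻ p (x ∷ xs) h with p x in eq
... | false = x , here refl , eq
... | true with all-false⁻ p xs h
... | y , m , e = y , there m , e

any-cong : ∀ {A : Set} {p q : A → Bool} → (∀ x → p x ≡ q x) → ∀ xs → any p xs ≡ any q xs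
any-cong h [] = refl
any-cong h (x ∷ xs) = cong₂ _∨_ (h x) (any-cong h xs)

^-distribʳ-* : ∀ T a b → (a * b) ^ T ≡ a ^ T * b ^ T
^-distribʳ-* zero a b = refl
^-distribʳ-* (suc T) a b = trans (cong (a * b *_) (^-distribʳ-* T a b)) (arrange a b (a ^ T) (b ^ T))
  where
  arrange : ∀ a b x y → a * b * (x * y) ≡ a * x * (b * y)
  arrange = solve-∀

-- Counting offers

withZero : ∀ {n} → Fin n → Offer (suc n)
withZero j = (zero , suc j) , s≤s z≤n

shift : ∀ {n} → Offer n → Offer (suc n)
shift ((i , j) , p) = (suc i , suc j) , s≤s p

-- Splitting off the vertex `zero` follows Pascal's rule, and also the recursion of a double sum
-- over `Fin n`.
allOffers : ∀ n → List (Offer n)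
allOffers zero = []
allOffers (suc n) = List.tabulate withZero ++ map shift (allOffers n)

length-allOffers : ∀ n → length (allOffers n) ≡ n Comb.C 2
length-allOffers zero = refl
length-allOffers (suc n) = begin
  length (List.tabulate withZero ++ map shift (allOffers n)) ≡⟨ length-++ (List.tabulate (withZero {n})) ⟩
  length (List.tabulate (withZero {n})) + length (map shift (allOffers n))
    ≡⟨ cong₂ _+_ (length-tabulate (withZero {n})) (trans (length-map shift (allOffers n)) (length-allOffers n)) ⟩
  n + n Comb.C 2 ≡⟨ cong (_+ n Comb.C 2) (sym (Comb.nC1≡n n)) ⟩
  n Comb.C 1 + n Comb.C 2 ≡⟨ Comb.nCk+nC[k+1]≡[n+1]C[k+1] n 1 ⟩
  suc n Comb.C 2 ∎
  where
  open ≡-Reasoning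

offer-≡ : ∀ {n} {o o′ : Offer n} → proj₁ o ≡ proj₁ o′ → o ≡ o′
offer-≡ {o = _ , p} {_ , q} refl = cong (_ ,_) (≤-irrelevant p q)

unique-allOffers : ∀ n → Unique (allOffers n)
unique-allOffers zero = []
unique-allOffers (suc n) = Uniqueₚ.++⁺ (Uniqueₚ.tabulate⁺ λ { refl → refl })
  (Uniqueₚ.map⁺ (λ e → offer-≡ (shift-injective (cong proj₁ e))) (unique-allOffers n))
  λ (m , m′) → disjoint m m′
  where
  shift-injective : ∀ {p q : Fin n × Fin n} → (suc (proj₁ p) , suc (proj₂ p)) ≡ (suc (proj₁ q) , suc (proj₂ q)) → p ≡ q
  shift-injective refl = refl
  disjoint : ∀ {o : Offer (suc n)} → o ∈ List.tabulate withZero → o ∈ map shift (allOffers n) → ⊥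
  disjoint m m′ with ∈-tabulate⁻ m | ∈-map⁻ _ m′
  ... | _ , refl | _ , _ , ()

ΣL-tabulate : ∀ {A : Set} {n} (g : Fin n → A) (f : A → ℕ) → ΣL (List.tabulate g) f ≡ sum (f ∘ g)
ΣL-tabulate {n = zero} g f = refl
ΣL-tabulate {n = suc n} g f = cong (f (g zero) +_) (ΣL-tabulate (g ∘ suc) f)

-- A square matrix consists of its diagonal and of two entries for each unordered pair. Numbers of
-- offers thereby reduce to products of set sizes.
ΣL-allOffers : ∀ n (f : Fin n → Fin n → ℕ) →
  ΣL (allOffers n) (λ ((i , j) , _) → f i j + f j i) + sum (λ i → f i i) ≡ sum (λ i → sum (f i))
ΣL-allOffers zero f = refl
ΣL-allOffers (suc n) f = begin
  ΣL (allOffers (suc n)) g + (d + D)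
    ≡⟨ cong (_+ (d + D)) (trans (ΣL-++ (List.tabulate withZero) (map shift (allOffers n)) g)
    (cong₂ _+_ (ΣL-tabulate withZero g) (ΣL-map shift (allOffers n) g))) ⟩
  (sum (λ j → f zero (suc j) + f (suc j) zero) + I) + (d + D)
    ≡⟨ cong (λ k → k + I + (d + D)) (∑-distrib-+ (λ j → f zero (suc j)) (λ j → f (suc j) zero)) ⟩
  ((R + L) + I) + (d + D) ≡⟨ rearrange R L I d D ⟩
  (d + R) + (L + (I + D)) ≡⟨ cong (λ k → d + R + (L + k)) (ΣL-allOffers n (λ i j → f (suc i) (suc j))) ⟩
  (d + R) + (L + sum (λ i → sum (λ j → f (suc i) (suc j))))
    ≡⟨ cong (d + R +_) (sym (∑-distrib-+ (λ i → f (suc i) zero) _)) ⟩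
  (d + R) + sum (λ i → sum (f (suc i))) ∎
  where
  open ≡-Reasoning
  g : Offer (suc n) → ℕ
  g ((i , j) , _) = f i j + f j i
  d = f zero zero
  D = sum (λ i → f (suc i) (suc i))
  R = sum (λ j → f zero (suc j))
  L = sum (λ j → f (suc j) zero)
  I = ΣL (allOffers n) (λ ((i , j) , _) → f (suc i) (suc j) + f (suc j) (suc i))
  rearrange : ∀ R L I d D → ((R + L) + I) + (d + D) ≡ (d + R) + (L + (I + D))
  rearrange = solve-∀

sum-product : ∀ {m n} (f : Fin m → ℕ) (g : Fin n → ℕ) → sum (λ i → sum (λ j → f i * g j)) ≡ sum f * sum g
sum-product f g = trans (sum-cong-≗ λ i → sym (*-distribˡ-sum (f i) g)) (sym (*-distribʳ-sum (sum g) f))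

within : ∀ {n} → Sub n → Offer n → Bool
within P ((i , j) , _) = P i ∧ P j

crosses : ∀ {n} → Sub n → Sub n → Offer n → Bool
crosses S T ((i , j) , _) = (S i ∧ T j) ∨ (S j ∧ T i)

count-within : ∀ {n} (P : Sub n) → ΣL (allOffers n) (χ ∘ within P) * 2 + size P ≡ size P * size P
count-within {n} P = begin
  ΣL (allOffers n) (χ ∘ within P) * 2 + size P ≡⟨ cong₂ _+_
     (trans (ΣL-*ʳ (allOffers n) (χ ∘ within P) 2) (ΣL-cong (allOffers n) λ ((i , j) , _) → double (P i) (P j)))
     (sum-cong-≗ λ i → idem (P i)) ⟩
  ΣL (allOffers n) (λ ((i , j) , _) → χ (P i) * χ (P j) + χ (P j) * χ (P i)) + sum (λ i → χ (P i) * χ (P i))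
    ≡⟨ ΣL-allOffers n (λ i j → χ (P i) * χ (P j)) ⟩
  sum (λ i → sum (λ j → χ (P i) * χ (P j))) ≡⟨ sum-product (χ ∘ P) (χ ∘ P) ⟩
  size P * size P ∎
  where
  open ≡-Reasoning
  double : ∀ a b → χ (a ∧ b) * 2 ≡ χ a * χ b + χ b * χ a
  double true true = refl
  double true false = refl
  double false true = refl
  double false false = refl
  idem : ∀ a → χ a ≡ χ a * χ a
  idem true = refl
  idem false = refl

-- Disjointness empties the diagonal and excludes that one offer crosses in both directions.
count-crosses : ∀ {n} (S T : Sub n) → (∀ v → S v ≡ true → T v ≢ true) →
  size S * size T ≤ ΣL (allOffers n) (χ ∘ crosses S T)
count-crosses {n} S T disj = begin
  size S * size T ≡⟨ sym (sum-product (χ ∘ S) (χ ∘ T)) ⟩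
  sum (λ i → sum (λ j → χ (S i) * χ (T j))) ≡⟨ sym (ΣL-allOffers n (λ i j → χ (S i) * χ (T j))) ⟩
  ΣL (allOffers n) (λ ((i , j) , _) → χ (S i) * χ (T j) + χ (S j) * χ (T i)) + sum (λ i → χ (S i) * χ (T i))
    ≡⟨ cong (ΣL (allOffers n) (λ ((i , j) , _) → χ (S i) * χ (T j) + χ (S j) * χ (T i)) +_)
         (trans (sum-cong-≗ λ i → diag (disj i)) (size-∅ n)) ⟩
  ΣL (allOffers n) (λ ((i , j) , _) → χ (S i) * χ (T j) + χ (S j) * χ (T i)) + 0 ≡⟨ +-identityʳ _ ⟩
  ΣL (allOffers n) (λ ((i , j) , _) → χ (S i) * χ (T j) + χ (S j) * χ (T i))
    ≤⟨ ΣL-mono (allOffers n) (λ ((i , j) , _) → off (disj i) (disj j)) ⟩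
  ΣL (allOffers n) (χ ∘ crosses S T) ∎
  where
  open ≤-Reasoning
  diag : ∀ {a b} → (a ≡ true → b ≢ true) → χ a * χ b ≡ 0
  diag {true} {true} h = contradiction refl (h refl)
  diag {true} {false} h = refl
  diag {false} h = refl
  off : ∀ {a b c d} → (a ≡ true → c ≢ true) → (b ≡ true → d ≢ true) →
    χ a * χ d + χ b * χ c ≤ χ ((a ∧ d) ∨ (b ∧ c))
  off {true} {b} {true} h k = contradiction refl (h refl)
  off {true} {true} {false} {true} h k = contradiction refl (k refl)
  off {true} {true} {false} {false} h k = ≤-refl
  off {true} {false} {false} {true} h k = ≤-refl
  off {true} {false} {false} {false} h k = ≤-refl
  off {false} {true} {true} {d} h k = ≤-refl
  off {false} {true} {false} {d} h k = ≤-refl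
  off {false} {false} h k = z≤n

-- Counting sequences of offers

seqs : ∀ {A : Set} → List A → ∀ T → List (Vec A T)
seqs xs zero = [] ∷ []
seqs xs (suc T) = cartesianProductWith _∷_ xs (seqs xs T)

module _ {A : Set} (xs : List A) where

  ΣL-seqs-suc : ∀ T (f : Vec A (suc T) → ℕ) → ΣL (seqs xs (suc T)) f ≡ ΣL xs (λ x → ΣL (seqs xs T) (λ v → f (x ∷ v)))
  ΣL-seqs-suc T f = ΣL-product _∷_ xs (seqs xs T) f

  length-seqs : ∀ T → length (seqs xs T) ≡ length xs ^ T
  length-seqs zero = refl
  length-seqs (suc T) = begin
    length (seqs xs (suc T)) ≡⟨ sym (ΣL-length (seqs xs (suc T))) ⟩
    ΣL (seqs xs (suc T)) (λ _ → 1) ≡⟨ ΣL-seqs-suc T (λ _ → 1) ⟩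
    ΣL xs (λ _ → ΣL (seqs xs T) (λ _ → 1)) ≡⟨ ΣL-const xs _ ⟩
    length xs * ΣL (seqs xs T) (λ _ → 1) ≡⟨ cong (length xs *_) (trans (ΣL-length (seqs xs T)) (length-seqs T)) ⟩
    length xs ^ suc T ∎
    where open ≡-Reasoning

  unique-seqs : Unique xs → ∀ T → Unique (seqs xs T)
  unique-seqs u zero = [] ∷ []
  unique-seqs u (suc T) = Uniqueₚ.cartesianProductWith⁺ _∷_ ∷-injective u (unique-seqs u T)

  ∈-seqs : ∀ {T} (v : Vec A T) → (∀ x → x ∈ xs) → v ∈ seqs xs T
  ∈-seqs [] h = here refl
  ∈-seqs (x ∷ v) h = ∈-cartesianProductWith⁺ _∷_ (h x) (∈-seqs v h)

  -- Independence of the rounds, in the language of counting.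
  ΣL-seqs-all : ∀ (p : A → Bool) T → ΣL (seqs xs T) (λ v → χ (all p (toList v))) ≡ ΣL xs (χ ∘ p) ^ T
  ΣL-seqs-all p zero = refl
  ΣL-seqs-all p (suc T) = begin
    ΣL (seqs xs (suc T)) _ ≡⟨ ΣL-seqs-suc T _ ⟩
    ΣL xs (λ x → ΣL (seqs xs T) (λ v → χ (p x ∧ all p (toList v))))
      ≡⟨ ΣL-cong xs (λ x → trans (ΣL-cong (seqs xs T) λ v → trans (χ-∧ (p x) (all p (toList v))) (*-comm (χ (p x)) _)) (sym (ΣL-*ʳ (seqs xs T) _ (χ (p x))))) ⟩
    ΣL xs (λ x → ΣL (seqs xs T) (λ v → χ (all p (toList v))) * χ (p x))
      ≡⟨ ΣL-cong xs (λ x → trans (*-comm (ΣL (seqs xs T) (λ v → χ (all p (toList v)))) (χ (p x))) (cong (χ (p x) *_) (ΣL-seqs-all p T))) ⟩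
    ΣL xs (λ x → χ (p x) * ΣL xs (χ ∘ p) ^ T) ≡⟨ sym (ΣL-*ʳ xs (χ ∘ p) _) ⟩
    ΣL xs (χ ∘ p) ^ suc T ∎
    where open ≡-Reasoning

  -- The second phase may be averaged for each fixed outcome of the first, on which its plan
  -- depends.
  ΣL-seqs-split : ∀ T₁ {T₂} (f : Vec A T₁ → Vec A T₂ → ℕ) →
    ΣL (seqs xs (T₁ + T₂)) (λ v → f (take T₁ v) (drop T₁ v)) ≡ ΣL (seqs xs T₁) (λ a → ΣL (seqs xs T₂) (f a))
  ΣL-seqs-split zero f = sym (+-identityʳ _)
  ΣL-seqs-split (suc T₁) {T₂} f = trans (ΣL-seqs-suc (T₁ + T₂) _)
    (trans (ΣL-cong xs λ x → ΣL-seqs-split T₁ λ a b → f (x ∷ a) b) (sym (ΣL-seqs-suc T₁ _)))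

∈⇒≤ΣL : ∀ {A : Set} {x : A} {xs} (f : A → ℕ) → x ∈ xs → f x ≤ ΣL xs f
∈⇒≤ΣL f (here refl) = m≤m+n (f _) _
∈⇒≤ΣL f (there {y} m) = ≤-trans (∈⇒≤ΣL f m) (m≤n+m _ (f y))

-- The first phase

bools : List Bool
bools = true ∷ false ∷ []

∈-bools : ∀ b → b ∈ bools
∈-bools true = here refl
∈-bools false = there (here refl)

module Random {n : ℕ} (X Y : Sub n) (s : ℕ) where

  joins : Fin n → Fin n → Offer n → Bool
  joins u v ((i , j) , _) = (⁅ i ⁆ u ∧ ⁅ j ⁆ v) ∨ (⁅ j ⁆ u ∧ ⁅ i ⁆ v)

  adjacent : List (Offer n) → Fin n → Fin n → Bool
  adjacent acc u v = any (joins u v) acc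

  adjacent-sym : ∀ acc u v → adjacent acc u v ≡ adjacent acc v u
  adjacent-sym acc u v = any-cong (λ ((i , j) , _) →
    trans (Boolₚ.∨-comm (⁅ i ⁆ u ∧ ⁅ j ⁆ v) _) (cong₂ _∨_ (Boolₚ.∧-comm (⁅ j ⁆ u) _) (Boolₚ.∧-comm (⁅ i ⁆ u) _))) acc

  -- A pair S ⊆ X, T ⊆ Y is coded by S ∪ T.
  separates : List (Offer n) → Vec Bool n → Bool
  separates acc c = (does (s ≤? size (lookup c ∩ X)) ∧ does (s ≤? size (lookup c ∩ Y)))
    ∧ all (not ∘ crosses (lookup c ∩ X) (lookup c ∩ Y)) acc

  -- The strategy tests whether this number is zero; its average over all first phases is the union
  -- bound.
  separators : List (Offer n) → ℕ
  separators acc = ΣL (seqs bools n) (χ ∘ separates acc)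

  module _ (disjoint : ∀ v → X v ≡ true → Y v ≢ true) where

    -- An unjoined pair would be counted: its code occurs in the enumeration, and since `X` and `Y`
    -- are disjoint the pair can be recovered from the code.
    joined : ∀ acc → separators acc ≡ 0 → Graph.Joined (adjacent acc) s X Y
    joined acc none S T S⊆X T⊆Y s≤S s≤T with all-false⁻ _ acc noCross
      where
      c = tabulate (S ∪ T)
      S⊆ : S ⊆ lookup c ∩ X
      S⊆ v h = ∧⁺ (trans (lookup∘tabulate (S ∪ T) v) (∨⁺ˡ h)) (S⊆X v h)
      T⊆ : T ⊆ lookup c ∩ Y
      T⊆ v h = ∧⁺ (trans (lookup∘tabulate (S ∪ T) v) (∨⁺ʳ {S v} h)) (T⊆Y v h)
      χ≡0 : ∀ {b} → χ b ≤ 0 → b ≡ false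
      χ≡0 {false} _ = refl
      noCross : all (not ∘ crosses (lookup c ∩ X) (lookup c ∩ Y)) acc ≡ false
      noCross = trans (sym (cong₂ _∧_ (cong₂ _∧_
          (dec-true (s ≤? size (lookup c ∩ X)) (≤-trans s≤S (size-mono {S = S} S⊆)))
          (dec-true (s ≤? size (lookup c ∩ Y)) (≤-trans s≤T (size-mono {S = T} T⊆)))) refl))
        (χ≡0 (≤-trans (∈⇒≤ΣL (χ ∘ separates acc) (∈-seqs bools c ∈-bools)) (≤-reflexive none)))
    ... | ((i , j) , p) , m , e = found (∨⁻ (Boolₚ.not-injective e))
      where
      c = tabulate (S ∪ T)
      inS : ∀ {v} → (lookup c ∩ X) v ≡ true → S v ≡ true
      inS {v} h with ∨⁻ {S v} (trans (sym (lookup∘tabulate (S ∪ T) v)) (proj₁ (∧⁻ h)))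
      ... | inj₁ q = q
      ... | inj₂ q = ⊥-elim (disjoint v (proj₂ (∧⁻ {lookup c v} h)) (T⊆Y v q))
      inT : ∀ {v} → (lookup c ∩ Y) v ≡ true → T v ≡ true
      inT {v} h with ∨⁻ {S v} (trans (sym (lookup∘tabulate (S ∪ T) v)) (proj₁ (∧⁻ h)))
      ... | inj₁ q = ⊥-elim (disjoint v (S⊆X v q) (proj₂ (∧⁻ {lookup c v} h)))
      ... | inj₂ q = q
      found : (lookup c ∩ X) i ∧ (lookup c ∩ Y) j ≡ true ⊎ (lookup c ∩ X) j ∧ (lookup c ∩ Y) i ≡ true →
        ∃ λ u → ∃ λ v → S u ≡ true × T v ≡ true × adjacent acc u v ≡ true
      found (inj₁ h) = i , j , inS (proj₁ (∧⁻ h)) , inT (proj₂ (∧⁻ {(lookup c ∩ X) i} h)) ,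
        any⁺ (joins i j) m (∨⁺ˡ (∧⁺ (⁅⁆-self i) (⁅⁆-self j)))
      found (inj₂ h) = j , i , inS (proj₁ (∧⁻ h)) , inT (proj₂ (∧⁻ {(lookup c ∩ X) j} h)) ,
        any⁺ (joins j i) m (∨⁺ʳ {⁅ i ⁆ j ∧ ⁅ j ⁆ i} (∧⁺ (⁅⁆-self j) (⁅⁆-self i)))

    -- Union bound over the `2 ^ n` codes. A code with a small part contributes nothing; any other
    -- must be missed in each of the `T` independent rounds.
    separators-bound : ∀ R → length (allOffers n) * 4 ≡ R + s * s → ∀ T →
      ΣL (seqs (allOffers n) T) (separators ∘ toList) * 4 ^ T ≤ 2 ^ n * R ^ T
    separators-bound R 4N≡ T = begin
      ΣL Ω (separators ∘ toList) * 4 ^ T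
        ≡⟨ cong (_* 4 ^ T) (ΣL-swap Ω (seqs bools n) (λ os c → χ (separates (toList os) c))) ⟩
      ΣL (seqs bools n) (λ c → ΣL Ω (λ os → χ (separates (toList os) c))) * 4 ^ T ≡⟨ ΣL-*ʳ (seqs bools n) _ (4 ^ T) ⟩
      ΣL (seqs bools n) (λ c → ΣL Ω (λ os → χ (separates (toList os) c)) * 4 ^ T)
        ≤⟨ ΣL-bound (seqs bools n) _ (R ^ T) each ⟩
      length (seqs bools n) * R ^ T ≡⟨ cong (_* R ^ T) (length-seqs bools n) ⟩
      2 ^ n * R ^ T ∎
      where
      open ≤-Reasoning
      Ω = seqs (allOffers n) T
      vanish : ∀ {f} → (∀ os → f os ≡ 0) → ΣL Ω f * 4 ^ T ≤ R ^ T
      vanish h = ≤-trans (≤-reflexive (cong (_* 4 ^ T) (trans (ΣL-cong Ω h) (trans (ΣL-const Ω 0) (*-zeroʳ (length Ω)))))) z≤n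
      each : ∀ c → ΣL Ω (λ os → χ (separates (toList os) c)) * 4 ^ T ≤ R ^ T
      each c with s ≤? size (lookup c ∩ X) | s ≤? size (lookup c ∩ Y)
      ... | no s≰X | _ = vanish λ os → cong (λ b → χ ((b ∧ does (s ≤? size (lookup c ∩ Y))) ∧ _)) (dec-false (s ≤? size (lookup c ∩ X)) s≰X)
      ... | yes _ | no s≰Y = vanish λ os → cong χ (cong (_∧ _) (trans (cong (does (s ≤? size (lookup c ∩ X)) ∧_)
          (dec-false (s ≤? size (lookup c ∩ Y)) s≰Y)) (Boolₚ.∧-zeroʳ _)))
      ... | yes s≤X | yes s≤Y = begin
        ΣL Ω (λ os → χ (separates (toList os) c)) * 4 ^ T
          ≤⟨ *-monoˡ-≤ (4 ^ T) (ΣL-mono Ω λ os → χ-mono {separates (toList os) c}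
          (proj₂ ∘ ∧⁻ {does (s ≤? size (lookup c ∩ X)) ∧ does (s ≤? size (lookup c ∩ Y))})) ⟩
        ΣL Ω (λ os → χ (all (not ∘ cr) (toList os))) * 4 ^ T
          ≡⟨ cong (_* 4 ^ T) (ΣL-seqs-all (allOffers n) (not ∘ cr) T) ⟩
        ΣL (allOffers n) (χ ∘ not ∘ cr) ^ T * 4 ^ T ≡⟨ sym (^-distribʳ-* T (ΣL (allOffers n) (χ ∘ not ∘ cr)) 4) ⟩
        (ΣL (allOffers n) (χ ∘ not ∘ cr) * 4) ^ T ≤⟨ ^-monoˡ-≤ T (+-cancelʳ-≤ (s * s) _ R main) ⟩
        R ^ T ∎
        where
        cr = crosses (lookup c ∩ X) (lookup c ∩ Y)
        χ-not : ∀ b → χ (not b) + χ b ≡ 1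
        χ-not true = refl
        χ-not false = refl
        total : ΣL (allOffers n) (χ ∘ not ∘ cr) + ΣL (allOffers n) (χ ∘ cr) ≡ length (allOffers n)
        total = trans (sym (ΣL-+ (allOffers n) (χ ∘ not ∘ cr) (χ ∘ cr)))
          (trans (ΣL-cong (allOffers n) (χ-not ∘ cr)) (ΣL-length (allOffers n)))
        main : ΣL (allOffers n) (χ ∘ not ∘ cr) * 4 + s * s ≤ R + s * s
        main = begin
          -- A factor `4` is given away here, so that the rate agrees with that of the second phase.
          a * 4 + s * s ≤⟨ +-monoʳ-≤ (a * 4) (≤-trans (*-mono-≤ s≤X s≤Y)
             (≤-trans (count-crosses (lookup c ∩ X) (lookup c ∩ Y)
               λ v h k → disjoint v (proj₂ (∧⁻ {lookup c v} h)) (proj₂ (∧⁻ {lookup c v} k))) (m≤m*n _ 4))) ⟩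
          a * 4 + ΣL (allOffers n) (χ ∘ cr) * 4 ≡⟨ sym (*-distribʳ-+ 4 a _) ⟩
          (a + ΣL (allOffers n) (χ ∘ cr)) * 4 ≡⟨ cong (_* 4) total ⟩
          length (allOffers n) * 4 ≡⟨ 4N≡ ⟩
          R + s * s ∎
          where
          a = ΣL (allOffers n) (χ ∘ not ∘ cr)

-- The second phase

module Cover {n : ℕ} where

  remove : Sub n → Offer n → Sub n
  remove P ((i , j) , _) v = (P v ∧ not (⁅ i ⁆ v)) ∧ not (⁅ j ⁆ v)

  State : Set
  State = List (Fin n) × Sub n

  step : State → Offer n → State
  step ([] , P) o = [] , P
  step (t ∷ ts , P) o = if within P o then (ts , remove P o) else (t ∷ ts , P)

  unfinished : State → List (Offer n) → Bool
  unfinished ([] , P) os = false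
  unfinished (t ∷ ts , P) [] = true
  unfinished st@(_ ∷ _ , _) (o ∷ os) = unfinished (step st o) os

  size-remove : ∀ P o → within P o ≡ true → size P ≡ 2 + size (remove P o)
  size-remove P ((i , j) , p) h = begin
    size P ≡⟨ size-∖ {S = ⁅ i ⁆} {P} (λ v k → subst (λ w → P w ≡ true) (sym (⁅⁆⁻ k)) (proj₁ (∧⁻ h))) ⟩
    size ⁅ i ⁆ + size (P ∖ ⁅ i ⁆) ≡⟨ cong₂ _+_ (size-⁅⁆ i) (size-∖ {S = ⁅ j ⁆} {P ∖ ⁅ i ⁆} j⊆) ⟩
    1 + (size ⁅ j ⁆ + size ((P ∖ ⁅ i ⁆) ∖ ⁅ j ⁆)) ≡⟨ cong (λ k → 1 + (k + size ((P ∖ ⁅ i ⁆) ∖ ⁅ j ⁆))) (size-⁅⁆ j) ⟩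
    2 + size ((P ∖ ⁅ i ⁆) ∖ ⁅ j ⁆) ∎
    where
    open ≡-Reasoning
    j⊆ : ⁅ j ⁆ ⊆ P ∖ ⁅ i ⁆
    j⊆ v k with refl ← ⁅⁆⁻ {u = j} {v} k = ∧⁺ (proj₂ (∧⁻ {P i} h)) (not⁺ λ e → <-irrefl (cong toℕ (sym (⁅⁆⁻ e))) p)

  module _ (s R : ℕ) (4N≡ : length (allOffers n) * 4 ≡ R + s * s) where

    -- Each success halves the potential 2 ^ (number of targets left), so its expectation
    -- decays by the factor R / 4N per round.
    unfinished-bound : ∀ T ts P → 1 + s + length ts * 2 ≤ size P →
      ΣL (seqs (allOffers n) T) (λ os → χ (unfinished (ts , P) (toList os))) * 4 ^ T ≤ 2 ^ length ts * R ^ T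
    unfinished-bound T [] P h = ≤-trans (≤-reflexive (cong (_* 4 ^ T)
      (trans (ΣL-const (seqs (allOffers n) T) 0) (*-zeroʳ (length (seqs (allOffers n) T)))))) z≤n
    unfinished-bound zero (t ∷ ts) P h = ≤-trans (s≤s z≤n) (≤-trans (^-monoʳ-≤ 2 (z≤n {suc (length ts)})) (≤-reflexive (sym (*-identityʳ _))))
    unfinished-bound (suc T) (t ∷ ts) P h = begin
      ΣL (seqs Ω (suc T)) (λ os → χ (unfinished (t ∷ ts , P) (toList os))) * 4 ^ suc T
        ≡⟨ cong (_* 4 ^ suc T) (ΣL-seqs-suc Ω T _) ⟩
      ΣL Ω F * (4 * 4 ^ T) ≡⟨ trans (cong (ΣL Ω F *_) (*-comm 4 (4 ^ T))) (sym (*-assoc (ΣL Ω F) (4 ^ T) 4)) ⟩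
      ΣL Ω F * 4 ^ T * 4 ≡⟨ cong (_* 4) (ΣL-*ʳ Ω F (4 ^ T)) ⟩
      W * 4 ≤⟨ +-cancelʳ-≤ (G * a * 4) _ _ cancelled ⟩
      2 ^ suc (length ts) * R ^ suc T ∎
      where
      open ≤-Reasoning
      Ω = allOffers n
      F : Offer n → ℕ
      F o = ΣL (seqs Ω T) (λ os → χ (unfinished (step (t ∷ ts , P) o) (toList os)))
      W = ΣL Ω (λ o → F o * 4 ^ T)
      G = 2 ^ length ts * R ^ T
      a = ΣL Ω (χ ∘ within P)
      1+s≤P : 1 + s ≤ size P
      1+s≤P = ≤-trans (m≤m+n (1 + s) _) h
      -- A pool of p vertices contains p(p - 1)/2 offers, and p is at least `1 + s`.
      s*s≤ : s * s ≤ a * 2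
      s*s≤ = +-cancelʳ-≤ (size P) _ _ (begin
        s * s + size P ≤⟨ square s (size P) 1+s≤P ⟩
        size P * size P ≡⟨ sym (count-within P) ⟩
        a * 2 + size P ∎)
        where
        square : ∀ s p → 1 + s ≤ p → s * s + p ≤ p * p
        square s (suc p) (s≤s le) = ≤-trans (≤-reflexive (+-comm (s * s) (suc p))) (+-monoʳ-≤ (suc p) (*-mono-≤ le (≤-trans le (n≤1+n p))))
      -- By induction the remaining rounds are bounded by `G` after a success and by `G * 2`
      -- otherwise. Summed over the offers, this saves `G` for each of the `a` successful ones.
      each : ∀ o → F o * 4 ^ T + G * χ (within P o) ≤ G * 2
      each o with within P o in eq
      ... | true = ≤-trans (+-monoˡ-≤ (G * 1) (unfinished-bound T ts (remove P o)
            (≤-pred (≤-pred (≤-trans (≤-reflexive (slack s (length ts))) (≤-trans h (≤-reflexive (size-remove P o eq))))))))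
          (≤-reflexive (double G))
        where
        double : ∀ G → G + G * 1 ≡ G * 2
        double = solve-∀
        slack : ∀ s l → 2 + (1 + s + l * 2) ≡ 1 + s + suc l * 2
        slack = solve-∀
      ... | false = ≤-trans (≤-reflexive (trans (cong (F′ +_) (*-zeroʳ G)) (+-identityʳ F′)))
          (≤-trans (unfinished-bound T (t ∷ ts) P h) (≤-reflexive (double (2 ^ length ts) (R ^ T))))
        where
        F′ = ΣL (seqs Ω T) (λ os → χ (unfinished (t ∷ ts , P) (toList os))) * 4 ^ T
        double : ∀ x y → 2 * x * y ≡ x * y * 2
        double = solve-∀
      W≤ : W + G * a ≤ length Ω * (G * 2)
      W≤ = begin
        W + G * a
          ≡⟨ cong (W +_) (trans (*-comm G a) (trans (ΣL-*ʳ Ω (χ ∘ within P) G) (ΣL-cong Ω λ o → *-comm (χ (within P o)) G))) ⟩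
        W + ΣL Ω (λ o → G * χ (within P o)) ≡⟨ sym (ΣL-+ Ω _ _) ⟩
        ΣL Ω (λ o → F o * 4 ^ T + G * χ (within P o)) ≤⟨ ΣL-bound Ω _ (G * 2) each ⟩
        length Ω * (G * 2) ∎
      cancelled : W * 4 + G * a * 4 ≤ 2 ^ suc (length ts) * R ^ suc T + G * a * 4
      cancelled = begin
        W * 4 + G * a * 4 ≡⟨ sym (*-distribʳ-+ 4 W (G * a)) ⟩
        (W + G * a) * 4 ≤⟨ *-monoˡ-≤ 4 W≤ ⟩
        length Ω * (G * 2) * 4 ≡⟨ arrange₁ (length Ω) G ⟩
        G * 2 * (length Ω * 4) ≡⟨ cong (G * 2 *_) 4N≡ ⟩
        G * 2 * (R + s * s) ≡⟨ *-distribˡ-+ (G * 2) R (s * s) ⟩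
        G * 2 * R + G * 2 * (s * s) ≤⟨ +-monoʳ-≤ (G * 2 * R) (*-monoʳ-≤ (G * 2) s*s≤) ⟩
        G * 2 * R + G * 2 * (a * 2) ≡⟨ arrange₂ (2 ^ length ts) (R ^ T) R a ⟩
        2 ^ suc (length ts) * R ^ suc T + G * a * 4 ∎
        where
        arrange₁ : ∀ l G → l * (G * 2) * 4 ≡ G * 2 * (l * 4)
        arrange₁ = solve-∀
        arrange₂ : ∀ x y R a → x * y * 2 * R + x * y * 2 * (a * 2) ≡ 2 * x * (R * y) + x * y * a * 4
        arrange₂ = solve-∀

-- Degrees as sums of incidences

elements : ∀ {n} → Sub n → List (Fin n)
elements {zero} A = []
elements {suc n} A = (if A zero then zero ∷ [] else []) ++ map suc (elements (A ∘ suc))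

ΣL-elements : ∀ {n} (A : Sub n) v → ΣL (elements A) (δ v) ≡ χ (A v)
ΣL-elements {suc n} A v = trans (ΣL-++ (if A zero then zero ∷ [] else []) (map suc (elements (A ∘ suc))) (δ v))
  (trans (cong (ΣL (if A zero then zero ∷ [] else []) (δ v) +_) (ΣL-map suc (elements (A ∘ suc)) (δ v))) (cases v))
  where
  cases : ∀ v → ΣL (if A zero then zero ∷ [] else []) (δ v) + ΣL (elements (A ∘ suc)) (δ v ∘ suc) ≡ χ (A v)
  cases zero with A zero
  ... | true = cong suc (trans (ΣL-const (elements (A ∘ suc)) 0) (*-zeroʳ (length (elements (A ∘ suc)))))
  ... | false = trans (ΣL-const (elements (A ∘ suc)) 0) (*-zeroʳ (length (elements (A ∘ suc))))
  cases (suc v) with A zero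
  ... | true = ΣL-elements (A ∘ suc) v
  ... | false = ΣL-elements (A ∘ suc) v

sum-δ : ∀ {A : Set} {n} (xs : List A) (f : A → Fin n) → sum (λ v → ΣL xs (δ v ∘ f)) ≡ length xs
sum-δ xs f = trans (ΣL-sum-swap xs (λ x v → δ v (f x))) (trans (ΣL-cong xs λ x → size-⁅⁆ (f x)) (ΣL-length xs))

length-elements : ∀ {n} (A : Sub n) → length (elements A) ≡ size A
length-elements A = trans (sym (sum-δ (elements A) (λ x → x))) (sum-cong-≗ (ΣL-elements A))

incidence : ∀ {n} → Fin n → Edge n → ℕ
incidence v (a , b , c) = δ v a + δ v b + δ v c

length-filter : ∀ {A : Set} {P : A → Set} (P? : ∀ x → Dec (P x)) xs → length (filter P? xs) ≡ ΣL xs (χ ∘ does ∘ P?)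
length-filter P? [] = refl
length-filter P? (x ∷ xs) with P? x
... | yes _ = cong suc (length-filter P? xs)
... | no _ = length-filter P? xs

-- `degree` counts edges and `incidence` counts positions within edges. Properness makes them agree,
-- and incidences are additive.
degree-incidence : ∀ {n} (v : Fin n) {M : List (Edge n)} → All Proper M → degree v M ≡ ΣL M (incidence v)
degree-incidence v {M} proper = trans (length-filter (v ∈ₑ?_) M) (go proper)
  where
  one : ∀ e → Proper e → χ (does (v ∈ₑ? e)) ≡ incidence v e
  one (a , b , c) (a≢b , a≢c , b≢c) with v Fin.≟ a | v Fin.≟ b | v Fin.≟ c
  ... | yes refl | yes refl | _ = contradiction refl a≢b
  ... | yes refl | no _ | yes refl = contradiction refl a≢c
  ... | yes refl | no _ | no _ = refl
  ... | no _ | yes refl | yes refl = contradiction refl b≢c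
  ... | no _ | yes refl | no _ = refl
  ... | no _ | no _ | yes refl = refl
  ... | no _ | no _ | no _ = refl
  go : ∀ {M} → All Proper M → ΣL M (λ e → χ (does (v ∈ₑ? e))) ≡ ΣL M (incidence v)
  go [] = refl
  go (p ∷ ps) = cong₂ _+_ (one _ p) (go ps)

-- The strategy, and why it yields a perfect matching

-- Z is the set of all v with π v ∈ X, and Y is the disjoint union of Y₀ and P.
record Layout (n s : ℕ) : Set where
  field
    X Y₀ P       : Sub n
    π            : Fin n → Fin n
    π-involutive : ∀ v → π (π v) ≡ v
    partition    : ∀ v → χ (X v) + χ (X (π v)) + (χ (Y₀ v) + χ (P v)) ≡ 1
    size-X       : 4 * s ≤ size X
    size-Y₀      : 4 * s ≤ size Y₀
    size-P       : size P ≡ 10 * s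
    balance      : size Y₀ + size P ≡ size X + 6 * s

module Play {n s : ℕ} (L : Layout n s) (0<s : 0 < s) where
  open Layout L
  open Cover {n}

  Y : Sub n
  Y = Y₀ ∪ P

  private
    χ≡1 : ∀ {b} → b ≡ true → χ b ≡ 1
    χ≡1 refl = refl

    one≤Y : ∀ v → Y v ≡ true → 1 ≤ χ (Y₀ v) + χ (P v)
    one≤Y v h with Y₀ v
    ... | true = s≤s z≤n
    ... | false = ≤-reflexive (sym (χ≡1 h))

  disjoint : ∀ v → X v ≡ true → Y v ≢ true
  disjoint v x y = <⇒≢ (+-mono-≤ (≤-trans (≤-reflexive (sym (χ≡1 x))) (m≤m+n (χ (X v)) (χ (X (π v))))) (one≤Y v y)) (sym (partition v))

  X⇒π∉Y : ∀ v → X v ≡ true → Y (π v) ≢ true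
  X⇒π∉Y v x y = <⇒≢ (+-mono-≤ (≤-trans (≤-reflexive (sym (χ≡1 (trans (cong X (π-involutive v)) x)))) (m≤n+m (χ (X (π (π v)))) (χ (X (π v))))) (one≤Y (π v) y)) (sym (partition (π v)))

  X⇒π∉X : ∀ v → X v ≡ true → X (π v) ≢ true
  X⇒π∉X v x y = <⇒≢ (≤-trans (+-mono-≤ (≤-reflexive (sym (χ≡1 x))) (≤-reflexive (sym (χ≡1 y)))) (m≤m+n _ _)) (sym (partition v))

  disjoint-Y : ∀ v → Y₀ v ≡ true → P v ≢ true
  disjoint-Y v x y = <⇒≢ (≤-trans (+-mono-≤ (≤-reflexive (sym (χ≡1 x))) (≤-reflexive (sym (χ≡1 y)))) (m≤n+m _ (χ (X v) + χ (X (π v))))) (sym (partition v))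

  δ-π : ∀ v x → δ v (π x) ≡ δ (π v) x
  δ-π v x with v Fin.≟ π x | π v Fin.≟ x
  ... | yes _ | yes _ = refl
  ... | no _ | no _ = refl
  ... | yes refl | no ne = contradiction (π-involutive x) ne
  ... | no ne | yes refl = contradiction (sym (π-involutive v)) ne

  open Random X Y s

  -- All that the second phase needs to know about the first. By `count` the set `F` tops up `B` and
  -- `C`, so the number of targets depends on `size B` alone.
  record Plan (acc : List (Offer n)) : Set where
    open Graph (adjacent acc)
    field
      B C F : Sub n
      B⊆X   : B ⊆ X
      C⊆Y   : C ⊆ Y
      F⊆P   : F ⊆ P ∖ C
      B<s   : size B < s
      count : size B + size C + size F ≡ 2 * s
      expandsˣ : Expands s (X ∖ B) (Y₀ ∖ C)
      expandsʸ : Expands s (Y ∖ C) (X ∖ B)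

    targets : List (Fin n)
    targets = elements B ++ map π (elements B) ++ elements C ++ elements F

    pool : Sub n
    pool = (P ∖ C) ∖ F

    length-targets : length targets ≡ 2 * s + size B
    length-targets = begin
      length targets ≡⟨ length-++ (elements B) ⟩
      length (elements B) + length (map π (elements B) ++ elements C ++ elements F)
        ≡⟨ cong₂ _+_ (length-elements B) (trans (length-++ (map π (elements B))) (cong₂ _+_ (trans (length-map π (elements B)) (length-elements B))
            (trans (length-++ (elements C)) (cong₂ _+_ (length-elements C) (length-elements F))))) ⟩
      size B + (size B + (size C + size F)) ≡⟨ arrange (size B) (size C) (size F) ⟩
      size B + size C + size F + size B ≡⟨ cong (_+ size B) count ⟩
      2 * s + size B ∎
      where
      open ≡-Reasoning
      arrange : ∀ b c f → b + (b + (c + f)) ≡ b + c + f + b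
      arrange = solve-∀

    ΣL-targets : ∀ v → ΣL targets (δ v) ≡ χ (B v) + (χ (B (π v)) + (χ (C v) + χ (F v)))
    ΣL-targets v = trans (ΣL-++ (elements B) _ (δ v)) (cong₂ _+_ (ΣL-elements B v)
      (trans (ΣL-++ (map π (elements B)) _ (δ v)) (cong₂ _+_
        (trans (ΣL-map π (elements B) (δ v)) (trans (ΣL-cong (elements B) (δ-π v)) (ΣL-elements B (π v))))
        (trans (ΣL-++ (elements C) _ (δ v)) (cong₂ _+_ (ΣL-elements C v) (ΣL-elements F v))))))

    split-Y : ∀ v → χ ((Y₀ ∖ C) v) + χ (pool v) + (χ (C v) + χ (F v)) ≡ χ (Y₀ v) + χ (P v)
    split-Y v = pointwise (disjoint-Y v) (C⊆Y v) (F⊆P v)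
      where
      pointwise : ∀ {y p c f} → (y ≡ true → p ≢ true) → (c ≡ true → y ∨ p ≡ true) → (f ≡ true → p ∧ not c ≡ true) →
        χ (y ∧ not c) + χ ((p ∧ not c) ∧ not f) + (χ c + χ f) ≡ χ y + χ p
      pointwise {true} {true} h _ _ = contradiction refl (h refl)
      pointwise {true} {false} {true} {true} _ _ h with () ← h refl
      pointwise {true} {false} {false} {true} _ _ h with () ← h refl
      pointwise {true} {false} {true} {false} _ _ h = refl
      pointwise {true} {false} {false} {false} _ _ h = refl
      pointwise {false} {true} {true} {true} _ _ h with () ← h refl
      pointwise {false} {true} {true} {false} _ _ h = refl
      pointwise {false} {true} {false} {true} _ _ h = refl
      pointwise {false} {true} {false} {false} _ _ h = refl
      pointwise {false} {false} {true} _ h _ with () ← h refl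
      pointwise {false} {false} {false} {true} _ _ h with () ← h refl
      pointwise {false} {false} {false} {false} _ _ h = refl

    size-split-Y : size (Y₀ ∖ C) + size pool + (size C + size F) ≡ size X + 6 * s
    size-split-Y = begin
      size (Y₀ ∖ C) + size pool + (size C + size F)
        ≡⟨ sym (cong₂ _+_ (∑-distrib-+ (χ ∘ (Y₀ ∖ C)) (χ ∘ pool)) (∑-distrib-+ (χ ∘ C) (χ ∘ F))) ⟩
      sum (λ v → χ ((Y₀ ∖ C) v) + χ (pool v)) + sum (λ v → χ (C v) + χ (F v))
        ≡⟨ sym (∑-distrib-+ (λ v → χ ((Y₀ ∖ C) v) + χ (pool v)) (λ v → χ (C v) + χ (F v))) ⟩
      sum (λ v → χ ((Y₀ ∖ C) v) + χ (pool v) + (χ (C v) + χ (F v))) ≡⟨ sum-cong-≗ split-Y ⟩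
      sum (λ v → χ (Y₀ v) + χ (P v)) ≡⟨ ∑-distrib-+ (χ ∘ Y₀) (χ ∘ P) ⟩
      size Y₀ + size P ≡⟨ balance ⟩
      size X + 6 * s ∎
      where open ≡-Reasoning

    -- No vertex is targeted twice or lies in the pool as well as among the targets. This makes the
    -- edges of the second phase proper and disjoint.
    exclusive : ∀ v → ΣL targets (δ v) + χ (pool v) ≤ 1
    exclusive v = begin
      ΣL targets (δ v) + χ (pool v) ≡⟨ cong (_+ χ (pool v)) (ΣL-targets v) ⟩
      χ (B v) + (χ (B (π v)) + (χ (C v) + χ (F v))) + χ (pool v)
        ≡⟨ arrange (χ (B v)) (χ (B (π v))) (χ (C v) + χ (F v)) (χ (pool v)) ⟩
      χ (B v) + χ (B (π v)) + (χ (pool v) + (χ (C v) + χ (F v)))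
        ≤⟨ +-mono-≤ (+-mono-≤ (χ-mono (B⊆X v)) (χ-mono (B⊆X (π v))))
             (≤-trans (+-monoˡ-≤ _ (m≤n+m (χ (pool v)) (χ ((Y₀ ∖ C) v)))) (≤-reflexive (split-Y v))) ⟩
      χ (X v) + χ (X (π v)) + (χ (Y₀ v) + χ (P v)) ≡⟨ partition v ⟩
      1 ∎
      where
      open ≤-Reasoning
      arrange : ∀ a b c d → a + (b + c) + d ≡ a + b + (d + c)
      arrange = solve-∀

    -- Each target costs two pool vertices; the surplus `1 + s` keeps every round likely enough to
    -- succeed until the end.
    room : 1 + s + length targets * 2 ≤ size pool
    room = +-cancelʳ-≤ (size C + size F) _ _ (begin
      1 + s + length targets * 2 + (size C + size F) ≡⟨ cong (λ l → 1 + s + l * 2 + (size C + size F)) length-targets ⟩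
      1 + s + (2 * s + size B) * 2 + (size C + size F) ≡⟨ arrange₁ s (size B) (size C) (size F) ⟩
      suc (size B) + (size B + size C + size F) + 5 * s ≡⟨ cong (λ k → suc (size B) + k + 5 * s) count ⟩
      suc (size B) + 2 * s + 5 * s ≤⟨ +-monoˡ-≤ (5 * s) (+-monoˡ-≤ (2 * s) B<s) ⟩
      s + 2 * s + 5 * s ≤⟨ m≤m+n _ (2 * s) ⟩
      s + 2 * s + 5 * s + 2 * s ≡⟨ arrange₂ s ⟩
      10 * s ≡⟨ sym size-P ⟩
      size P ≤⟨ size-∖≥ P C ⟩
      size C + size (P ∖ C) ≡⟨ cong (size C +_) (size-∖ {S = F} {P ∖ C} F⊆P) ⟩
      size C + (size F + size pool) ≡⟨ arrange₃ (size C) (size F) (size pool) ⟩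
      size pool + (size C + size F) ∎)
      where
      open ≤-Reasoning
      arrange₁ : ∀ s b c f → 1 + s + (2 * s + b) * 2 + (c + f) ≡ suc b + (b + c + f) + 5 * s
      arrange₁ = solve-∀
      arrange₂ : ∀ s → s + 2 * s + 5 * s + 2 * s ≡ 10 * s
      arrange₂ = solve-∀
      arrange₃ : ∀ c f p → c + (f + p) ≡ p + (c + f)
      arrange₃ = solve-∀

    targets-few : length targets ≤ 3 * s
    targets-few = ≤-trans (≤-reflexive length-targets) (≤-trans (+-monoʳ-≤ (2 * s) (<⇒≤ B<s)) (≤-reflexive (arrange s)))
      where
      arrange : ∀ s → 2 * s + s ≡ 3 * s
      arrange = solve-∀

  -- Deletion starts from empty sets with `X₀ = X`: unlike `Y`, the side `X` loses nothing to
  -- unpredictable offers. `P` is large enough to supply the fillers outside `C`.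
  makePlan : ∀ acc → separators acc ≡ 0 → Plan acc
  makePlan acc none = plan (peel jXY jYX (λ v h → h) (λ v → ∨⁺ˡ) size-X size-Y₀ (s + s) ∅ ∅ empty (m≤n+m (s + s) (size {n} ∅ + size {n} ∅)))
    where
    open Graph (adjacent acc)
    jXY : Joined s X Y
    jXY = joined disjoint acc none
    jYX : Joined s Y X
    jYX S T S⊆Y T⊆X a b with jXY T S T⊆X S⊆Y b a
    ... | u , v , p , q , r = v , u , q , p , trans (adjacent-sym acc v u) r
    N∅ : ∀ A → size (N ∅ ∩ A) ≤ size {n} ∅
    N∅ A = size-mono {S = N ∅ ∩ A} λ v h → proj₁ (proj₂ (N⁻ ∅ {v} (proj₁ (∧⁻ {N ∅ v} {A v} h))))
    0<s′ : size {n} ∅ < s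
    0<s′ = subst (_< s) (sym (size-∅ n)) 0<s
    empty : Peeled s X X Y Y₀ ∅ ∅
    empty = record { B⊆X = λ v () ; C⊆Y = λ v () ; B<s = 0<s′ ; C<s = 0<s′ ; N-B = N∅ (Y₀ ∖ ∅) ; N-C = N∅ (X ∖ ∅) }
    plan : (∃ λ B → ∃ λ C → Peeled s X X Y Y₀ B C × Expands s (X ∖ B) (Y₀ ∖ C) × Expands s (Y ∖ C) (X ∖ B)) → Plan acc
    plan (B , C , peeled , eX , eY) = record
      { B = B ; C = C ; F = proj₁ chosen ; B⊆X = B⊆X ; C⊆Y = C⊆Y ; F⊆P = proj₁ (proj₂ chosen) ; B<s = B<s
      ; count = trans (cong (size B + size C +_) (proj₂ (proj₂ chosen))) (m+[n∸m]≡n B+C≤)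
      ; expandsˣ = eX ; expandsʸ = eY }
      where
      open Peeled peeled
      B+C≤ : size B + size C ≤ 2 * s
      B+C≤ = ≤-trans (+-mono-≤ (<⇒≤ B<s) (<⇒≤ C<s)) (≤-reflexive (cong (s +_) (sym (+-identityʳ s))))
      chosen = choose (P ∖ C) (2 * s ∸ (size B + size C)) (+-cancelˡ-≤ s _ _ (begin
        s + (2 * s ∸ (size B + size C)) ≤⟨ +-monoʳ-≤ s (m∸n≤m (2 * s) (size B + size C)) ⟩
        s + 2 * s ≤⟨ m≤m+n _ (7 * s) ⟩
        s + 2 * s + 7 * s ≡⟨ arrange s ⟩
        10 * s ≡⟨ sym size-P ⟩
        size P ≤⟨ size-∖≥ P C ⟩
        size C + size (P ∖ C) ≤⟨ +-monoˡ-≤ (size (P ∖ C)) (<⇒≤ C<s) ⟩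
        s + size (P ∖ C) ∎))
        where
        open ≤-Reasoning
        arrange : ∀ s → s + 2 * s + 7 * s ≡ 10 * s
        arrange = solve-∀

  planned : List (Offer n) → State
  planned acc with separators acc ≟ 0
  ... | yes none = let open Plan (makePlan acc none) in targets , pool
  -- A bad first phase is already counted as a failure. Without targets the second phase counts as
  -- finished, so it is not charged again.
  ... | no _ = [] , ∅

  data Phase : Set where
    first  : ℕ → List (Offer n) → Phase
    second : State → Phase

  -- The number in `first` counts the rounds of the first phase that follow the current one, hence
  -- the shift by one.
  enter : ℕ → List (Offer n) → Phase
  enter zero acc = second (planned acc)
  enter (suc r) acc = first r acc

  next : Phase → Offer n → Phase
  next (first r acc) o = enter r (acc ++ o ∷ [])
  next (second st) o = second (step st o)

  partner : Offer n → Fin n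
  partner ((i , j) , _) = if X i then π i else π j

  reply : Phase → Offer n → Fin n
  reply (first r acc) o = partner o
  reply (second ([] , _)) ((i , _) , _) = i
  reply (second (t ∷ _ , _)) o = t

  module _ (T₁ : ℕ) where

    phase : List (Offer n) → Phase
    phase [] = enter T₁ []
    phase (o ∷ h) = next (phase h) o

    strategy : Strategy n
    strategy h = reply (phase h)

  run : ∀ {T} → Phase → Vec (Offer n) T → List (Edge n)
  run ph [] = []
  run ph (o ∷ os) = (proj₁ (proj₁ o) , proj₂ (proj₁ o) , reply ph o) ∷ run (next ph o) os

  -- The strategy recomputes its state from the history in every round; `run` carries the state
  -- along, which suits induction.
  play≡run : ∀ {T} T₁ h (os : Vec (Offer n) T) → play (strategy T₁) h os ≡ run (phase T₁ h) os
  play≡run T₁ h [] = refl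
  play≡run T₁ h (o ∷ os) = cong (_ ∷_) (play≡run T₁ (o ∷ h) os)

  firstEdge : Offer n → Edge n
  firstEdge o = proj₁ (proj₁ o) , proj₂ (proj₁ o) , partner o

  run-first : ∀ {T₁ T₂} acc (os : Vec (Offer n) T₁) (os′ : Vec (Offer n) T₂) →
    run (enter T₁ acc) (os Vec.++ os′) ≡ map firstEdge (toList os) ++ run (second (planned (acc ++ toList os))) os′
  run-first acc [] os′ = cong (λ a → run (second (planned a)) os′) (sym (++-identityʳ acc))
  run-first acc (o ∷ os) os′ = cong (firstEdge o ∷_) (trans (run-first (acc ++ o ∷ []) os os′)
    (cong (λ a → map firstEdge (toList os) ++ run (second (planned a)) os′) (++-assoc acc (o ∷ []) (toList os))))

  -- `covered` is a conservation law with multiplicities: used edges and surviving pool together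
  -- make up targets and initial pool. Which vertices survive depends on the offers; by `size-rest`
  -- their number does not.
  record Covering (H : List (Edge n)) (ts : List (Fin n)) (P : Sub n) : Set where
    field
      used    : List (Edge n)
      rest    : Sub n
      used∈   : All (_∈ H) used
      proper  : All Proper used
      rest⊆   : rest ⊆ P
      covered : ∀ v → ΣL used (incidence v) + χ (rest v) ≡ ΣL ts (δ v) + χ (P v)
      size-rest : size P ≡ length ts * 2 + size rest

  cover : ∀ {T} ts P (os : Vec (Offer n) T) → unfinished (ts , P) (toList os) ≡ false →
    (∀ v → ΣL ts (δ v) + χ (P v) ≤ 1) → Covering (run (second (ts , P)) os) ts P
  cover [] P os h excl = record { used = [] ; rest = P ; used∈ = [] ; proper = [] ; rest⊆ = λ v p → p ; covered = λ v → refl ; size-rest = refl }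
  cover (t ∷ ts) P (o@((i , j) , i<j) ∷ os) h excl with within P o in eq
  ... | false = record { Covering c ; used∈ = All.map there (Covering.used∈ c) }
    where c = cover (t ∷ ts) P os h excl
  ... | true = record
    { used = (i , j , t) ∷ used ; rest = rest ; used∈ = here refl ∷ All.map there used∈
    ; proper = ((λ e → <-irrefl (cong toℕ e) i<j) , t≢ i (proj₁ (∧⁻ eq)) , t≢ j (proj₂ (∧⁻ {P i} eq))) ∷ proper
    ; rest⊆ = λ v r → proj₁ (∧⁻ (proj₁ (∧⁻ {P v ∧ not (⁅ i ⁆ v)} (rest⊆ v r))))
    ; covered = λ v → begin
        δ v i + δ v j + δ v t + ΣL used (incidence v) + χ (rest v) ≡⟨ +-assoc (δ v i + δ v j + δ v t) _ _ ⟩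
        δ v i + δ v j + δ v t + (ΣL used (incidence v) + χ (rest v)) ≡⟨ cong (δ v i + δ v j + δ v t +_) (covered v) ⟩
        δ v i + δ v j + δ v t + (ΣL ts (δ v) + χ (remove P o v)) ≡⟨ arrange (δ v i) (δ v j) (δ v t) _ _ ⟩
        δ v t + ΣL ts (δ v) + (δ v i + δ v j + χ (remove P o v)) ≡⟨ cong (δ v t + ΣL ts (δ v) +_) (sym (split v)) ⟩
        δ v t + ΣL ts (δ v) + χ (P v) ∎
    ; size-rest = trans (size-remove P o eq) (cong (2 +_) size-rest) }
    where
    open ≡-Reasoning
    arrange : ∀ a b c d e → a + b + c + (d + e) ≡ c + d + (a + b + e)
    arrange = solve-∀
    split : ∀ v → χ (P v) ≡ δ v i + δ v j + χ (remove P o v)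
    split v = trans (χ-∖ {P v} {⁅ i ⁆ v} λ k → subst (λ w → P w ≡ true) (sym (⁅⁆⁻ k)) (proj₁ (∧⁻ eq)))
      (trans (cong (δ v i +_) (χ-∖ {P v ∧ not (⁅ i ⁆ v)} {⁅ j ⁆ v} j∈)) (sym (+-assoc (δ v i) (δ v j) _)))
      where
      j∈ : ⁅ j ⁆ v ≡ true → P v ∧ not (⁅ i ⁆ v) ≡ true
      j∈ k with refl ← ⁅⁆⁻ {u = j} {v} k = ∧⁺ (proj₂ (∧⁻ {P i} eq)) (not⁺ λ e → <-irrefl (cong toℕ (sym (⁅⁆⁻ e))) i<j)
    t≢ : ∀ v → P v ≡ true → v ≢ t
    t≢ v p refl = <⇒≱ {1} (+-mono-≤ (≤-trans (≤-reflexive (sym (cong χ (⁅⁆-self v)))) (m≤m+n (δ v v) (ΣL ts (δ v)))) (≤-reflexive (sym (cong χ p)))) (excl v)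
    excl′ : ∀ v → ΣL ts (δ v) + χ (remove P o v) ≤ 1
    excl′ v = ≤-trans (+-mono-≤ (m≤n+m _ (δ v t)) (χ-mono {remove P o v} (λ k → proj₁ (∧⁻ (proj₁ (∧⁻ {P v ∧ not (⁅ i ⁆ v)} k)))))) (excl v)
    open Covering (cover ts (remove P o) os h excl′)

  -- Offers are ordered, so `x` may be either endpoint. The third vertex is recorded as `δ (π v) x`,
  -- which lets the sum over a matching be evaluated by `left` at `π v`.
  pairEdge : ∀ acc x y → X x ≡ true → Y y ≡ true → adjacent acc x y ≡ true →
    ∃ λ e → e ∈ map firstEdge acc × Proper e × (∀ v → incidence v e ≡ δ v x + δ v y + δ (π v) x)
  pairEdge acc x y x∈X y∈Y h with any⁻ (joins x y) acc h
  ... | o@((i , j) , p) , o∈ , e with ∨⁻ e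
  ... | inj₁ q with refl ← ⁅⁆⁻ {u = i} {x} (proj₁ (∧⁻ q)) | refl ← ⁅⁆⁻ {u = j} {y} (proj₂ (∧⁻ {⁅ i ⁆ x} q)) =
    firstEdge o , ∈-map⁺ firstEdge o∈ ,
    subst (λ z → Proper (x , y , z)) (sym isπ)
      ((λ e → <-irrefl (cong toℕ e) p) , (λ e → X⇒π∉X x x∈X (subst (λ w → X w ≡ true) e x∈X)) , (λ e → X⇒π∉Y x x∈X (subst (λ w → Y w ≡ true) e y∈Y))) ,
    λ v → trans (cong (λ z → incidence v (x , y , z)) isπ) (cong (δ v x + δ v y +_) (δ-π v x))
    where
    isπ : partner o ≡ π x
    isπ = cong (λ b → if b then π x else π y) x∈X
  ... | inj₂ q with refl ← ⁅⁆⁻ {u = j} {x} (proj₁ (∧⁻ q)) | refl ← ⁅⁆⁻ {u = i} {y} (proj₂ (∧⁻ {⁅ j ⁆ x} q)) =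
    firstEdge o , ∈-map⁺ firstEdge o∈ ,
    subst (λ z → Proper (y , x , z)) (sym isπ)
      ((λ e → <-irrefl (cong toℕ e) p) , (λ e → X⇒π∉Y x x∈X (subst (λ w → Y w ≡ true) e y∈Y)) , (λ e → X⇒π∉X x x∈X (subst (λ w → X w ≡ true) e x∈X))) ,
    λ v → trans (cong (λ z → incidence v (y , x , z)) isπ) (cong₂ _+_ (+-comm (δ v y) (δ v x)) (δ-π v x))
    where
    isπ : partner o ≡ π x
    isπ = cong (λ b → if b then π y else π x) (Boolₚ.¬-not λ k → disjoint y k y∈Y)

  pairEdges : ∀ acc {A Y′} (pairs : List (Fin n × Fin n)) → A ⊆ X → Y′ ⊆ Y →
    All (λ p → A (proj₁ p) ≡ true × Y′ (proj₂ p) ≡ true × adjacent acc (proj₁ p) (proj₂ p) ≡ true) pairs →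
    ∃ λ M → All (_∈ map firstEdge acc) M × All Proper M ×
      (∀ v → ΣL M (incidence v) ≡ ΣL pairs (δ v ∘ proj₁) + ΣL pairs (δ v ∘ proj₂) + ΣL pairs (δ (π v) ∘ proj₁))
  pairEdges acc [] _ _ [] = [] , [] , [] , λ v → refl
  pairEdges acc ((x , y) ∷ pairs) A⊆ Y′⊆ ((a , b , c) ∷ hs) with pairEdge acc x y (A⊆ x a) (Y′⊆ y b) c | pairEdges acc pairs A⊆ Y′⊆ hs
  ... | e , e∈ , prop , inc | M , M∈ , props , incs = e ∷ M , e∈ ∷ M∈ , prop ∷ props , λ v →
    trans (cong₂ _+_ (inc v) (incs v)) (arrange (δ v x) (δ v y) (δ (π v) x) _ _ _)
    where
    arrange : ∀ a b c d e f → a + b + c + (d + e + f) ≡ a + d + (b + e) + (c + f)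
    arrange = solve-∀

  perfectMatching : ∀ {T} acc (none : separators acc ≡ 0) (p : Plan acc) (os : Vec (Offer n) T) →
    let open Plan p in unfinished (targets , pool) (toList os) ≡ false →
    HasPerfectMatching (map firstEdge acc ++ run (second (targets , pool)) os)
  perfectMatching acc none p os fin =
    M₁ ++ used ,
    Allₚ.++⁺ (All.map ∈-++⁺ˡ M₁∈) (All.map (∈-++⁺ʳ (map firstEdge acc)) used∈) ,
    proper-M , λ v → trans (degree-incidence v proper-M) (trans (ΣL-++ M₁ used (incidence v)) (once v))
    where
    open Plan p
    open Covering (cover targets pool os fin exclusive)
    open Graph (adjacent acc)
    A = X ∖ B
    Y′ = (Y₀ ∖ C) ∪ rest
    rest⊆P∖C : rest ⊆ P ∖ C
    rest⊆P∖C v h = proj₁ (∧⁻ (rest⊆ v h))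
    Y′⊆ : Y′ ⊆ Y ∖ C
    Y′⊆ v h with ∨⁻ {Y₀ v ∧ not (C v)} h
    ... | inj₁ k = let a , b = ∧⁻ {Y₀ v} k in ∧⁺ (∨⁺ˡ a) b
    ... | inj₂ k = let a , b = ∧⁻ {P v} (rest⊆P∖C v k) in ∧⁺ (∨⁺ʳ {Y₀ v} a) b
    apart : ∀ v → (Y₀ ∖ C) v ≡ true → rest v ≢ true
    apart v h k = disjoint-Y v (proj₁ (∧⁻ h)) (proj₁ (∧⁻ (rest⊆P∖C v k)))
    -- `Y` loses `C` and `F`, together `2 * s` less `size B`, and twice `2 * s + size B` pool
    -- vertices: in all `6 * s + size B`. `X` loses `size B`, so the surplus `6 * s` of `Y` is
    -- exactly used up.
    A≡Y′ : size A ≡ size Y′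
    A≡Y′ = +-cancelʳ-≡ (size B + 6 * s) _ _ (begin
      size A + (size B + 6 * s)
        ≡⟨ trans (sym (+-assoc (size A) (size B) _)) (cong (_+ 6 * s) (trans (+-comm (size A) (size B)) (sym (size-∖ {S = B} {X} B⊆X)))) ⟩
      size X + 6 * s ≡⟨ sym size-split-Y ⟩
      size (Y₀ ∖ C) + size pool + (size C + size F)
        ≡⟨ cong (λ k → size (Y₀ ∖ C) + k + (size C + size F)) (trans size-rest (cong (λ l → l * 2 + size rest) length-targets)) ⟩
      size (Y₀ ∖ C) + ((2 * s + size B) * 2 + size rest) + (size C + size F)
        ≡⟨ arrange₁ (size (Y₀ ∖ C)) s (size B) (size rest) (size C) (size F) ⟩
      size (Y₀ ∖ C) + size rest + (size B + 4 * s + (size B + size C + size F))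
        ≡⟨ cong₂ (λ a b → a + (size B + 4 * s + b)) (sym (size-⊎ (Y₀ ∖ C) rest apart)) count ⟩
      size Y′ + (size B + 4 * s + 2 * s) ≡⟨ cong (size Y′ +_) (arrange₂ (size B) s) ⟩
      size Y′ + (size B + 6 * s) ∎)
      where
      open ≡-Reasoning
      arrange₁ : ∀ y s b r c f → y + ((2 * s + b) * 2 + r) + (c + f) ≡ y + r + (b + 4 * s + (b + c + f))
      arrange₁ = solve-∀
      arrange₂ : ∀ b s → b + 4 * s + 2 * s ≡ b + 6 * s
      arrange₂ = solve-∀
    matching : Matching A Y′
    matching = match (adjacent-sym acc) (joined disjoint acc none) (∖-⊆ X B) (λ v → ∨⁺ˡ) Y′⊆ A≡Y′ expandsˣ expandsʸ
    open Matching matching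
    -- As many right ends as vertices of `Y′`, and none repeated: every vertex of `Y′` is matched.
    right≡ : ∀ v → ΣL pairs (δ v ∘ proj₂) ≡ χ (Y′ v)
    right≡ = sum-antisym (λ v → ΣL pairs (δ v ∘ proj₂)) (χ ∘ Y′) right (≤-reflexive (begin
      size Y′ ≡⟨ sym A≡Y′ ⟩
      size A ≡⟨ sym (sum-cong-≗ left) ⟩
      sum (λ v → ΣL pairs (δ v ∘ proj₁)) ≡⟨ trans (sum-δ pairs proj₁) (sym (sum-δ pairs proj₂)) ⟩
      sum (λ v → ΣL pairs (δ v ∘ proj₂)) ∎))
      where open ≡-Reasoning
    firstPart = pairEdges acc pairs (∖-⊆ X B) (λ v h → proj₁ (∧⁻ (Y′⊆ v h))) edges
    M₁ = proj₁ firstPart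
    M₁∈ = proj₁ (proj₂ firstPart)
    proper-M : All Proper (M₁ ++ used)
    proper-M = Allₚ.++⁺ (proj₁ (proj₂ (proj₂ firstPart))) proper
    -- The vertices of `rest` are covered by `M₁`, whereas `covered` counts them beside the used
    -- edges; hence one copy of `χ (rest v)` is added and cancelled.
    once : ∀ v → ΣL M₁ (incidence v) + ΣL used (incidence v) ≡ 1
    once v = +-cancelʳ-≡ (χ (rest v)) _ _ (begin
      ΣL M₁ (incidence v) + ΣL used (incidence v) + χ (rest v) ≡⟨ +-assoc (ΣL M₁ (incidence v)) _ _ ⟩
      ΣL M₁ (incidence v) + (ΣL used (incidence v) + χ (rest v))
        ≡⟨ cong₂ _+_ (trans (proj₂ (proj₂ (proj₂ firstPart)) v) (cong₂ _+_ (cong₂ _+_ (left v) (trans (right≡ v) (χ-⊎ {(Y₀ ∖ C) v} (apart v)))) (left (π v))))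
                     (trans (covered v) (cong (_+ χ (pool v)) (ΣL-targets v))) ⟩
      χ (A v) + (χ ((Y₀ ∖ C) v) + χ (rest v)) + χ (A (π v)) + (χ (B v) + (χ (B (π v)) + (χ (C v) + χ (F v))) + χ (pool v))
        ≡⟨ arrange (χ (A v)) (χ ((Y₀ ∖ C) v)) (χ (rest v)) (χ (A (π v))) (χ (B v)) (χ (B (π v))) (χ (C v) + χ (F v)) (χ (pool v)) ⟩
      (χ (B v) + χ (A v)) + (χ (B (π v)) + χ (A (π v))) + (χ ((Y₀ ∖ C) v) + χ (pool v) + (χ (C v) + χ (F v))) + χ (rest v)
        ≡⟨ cong (_+ χ (rest v)) (cong₂ _+_ (cong₂ _+_ (sym (χ-∖ (B⊆X v))) (sym (χ-∖ (B⊆X (π v))))) (split-Y v)) ⟩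
      χ (X v) + χ (X (π v)) + (χ (Y₀ v) + χ (P v)) + χ (rest v) ≡⟨ cong (_+ χ (rest v)) (partition v) ⟩
      1 + χ (rest v) ∎)
      where
      open ≡-Reasoning
      arrange : ∀ a y r a′ b b′ cf p → a + (y + r) + a′ + (b + (b′ + cf) + p) ≡ (b + a) + (b′ + a′) + (y + p + cf) + r
      arrange = solve-∀

-- A concrete layout by intervals

below : ∀ {n} → ℕ → Sub n
below a v = toℕ v <ᵇ a

size-below : ∀ {n} a → a ≤ n → size {n} (below a) ≡ a
size-below {n} zero _ = size-∅ n
size-below {suc n} (suc a) (s≤s p) = cong suc (size-below a p)

<ᵇ-false : ∀ {a b} → b ≤ a → (a <ᵇ b) ≡ false
<ᵇ-false {a} {b} p = Boolₚ.¬-not λ h → <⇒≱ (<ᵇ⁻ h) p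

-- In increasing order: `X` and its copy, of length `m` each, then `P` of length `10 * s`, then `Y₀`
-- of length `y`. The involution exchanges the first two intervals and fixes the rest.
module Concrete {n m s y : ℕ} (n≡ : n ≡ m + m + 10 * s + y) (m≡ : m ≡ y + 4 * s) (4s≤y : 4 * s ≤ y) where

  mm≤n : m + m ≤ n
  mm≤n = ≤-trans (≤-trans (m≤m+n (m + m) (10 * s)) (m≤m+n _ y)) (≤-reflexive (sym n≡))

  q≤n : m + m + 10 * s ≤ n
  q≤n = ≤-trans (m≤m+n _ y) (≤-reflexive (sym n≡))

  flip : ℕ → ℕ
  flip x with x <? m | x <? m + m
  ... | yes _ | _ = m + x
  ... | no _ | yes _ = x ∸ m
  ... | no _ | no _ = x

  flip-low : ∀ {x} → x < m → flip x ≡ m + x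
  flip-low {x} p with x <? m
  ... | yes _ = refl
  ... | no np = contradiction p np

  flip-mid : ∀ {x} → m ≤ x → x < m + m → flip x ≡ x ∸ m
  flip-mid {x} p q with x <? m | x <? m + m
  ... | yes r | _ = contradiction p (<⇒≱ r)
  ... | no _ | yes _ = refl
  ... | no _ | no nq = contradiction q nq

  flip-high : ∀ {x} → m + m ≤ x → flip x ≡ x
  flip-high {x} p with x <? m | x <? m + m
  ... | yes r | _ = contradiction (≤-trans (m≤m+n m m) p) (<⇒≱ r)
  ... | no _ | yes r = contradiction p (<⇒≱ r)
  ... | no _ | no _ = refl

  data Place (x : ℕ) : Set where
    low  : x < m → Place x
    mid  : m ≤ x → x < m + m → x ∸ m < m → Place x
    high : m + m ≤ x → Place x

  place : ∀ x → Place x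
  place x with x <? m | x <? m + m
  ... | yes p | _ = low p
  ... | no p | yes q = mid (≮⇒≥ p) q (+-cancelˡ-< m _ _ (subst (_< m + m) (sym (m+[n∸m]≡n (≮⇒≥ p))) q))
  ... | no p | no q = high (≮⇒≥ q)

  flip-involutive : ∀ x → flip (flip x) ≡ x
  flip-involutive x with place x
  ... | low p = trans (cong flip (flip-low p)) (trans (flip-mid (m≤m+n m x) (+-monoʳ-< m p)) (m+n∸m≡n m x))
  ... | mid p q r = trans (cong flip (flip-mid p q)) (trans (flip-low r) (m+[n∸m]≡n p))
  ... | high p = trans (cong flip (flip-high p)) (flip-high p)

  flip<n : ∀ {x} → x < n → flip x < n
  flip<n {x} h with place x
  ... | low p = subst (_< n) (sym (flip-low p)) (≤-trans (+-monoʳ-< m p) mm≤n)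
  ... | mid p q r = subst (_< n) (sym (flip-mid p q)) (≤-trans r (≤-trans (m≤m+n m m) mm≤n))
  ... | high p = subst (_< n) (sym (flip-high p)) h

  π : Fin n → Fin n
  π v = fromℕ< (flip<n (toℕ<n v))

  toℕ-π : ∀ v → toℕ (π v) ≡ flip (toℕ v)
  toℕ-π v = toℕ-fromℕ< (flip<n (toℕ<n v))

  q = m + m + 10 * s

  Y₀ P : Sub n
  Y₀ = (λ _ → true) ∖ below q
  P = below q ∖ below (m + m)

  below-mm⊆ : below {n} (m + m) ⊆ below q
  below-mm⊆ v h = <ᵇ⁺ (≤-trans (<ᵇ⁻ h) (m≤m+n (m + m) (10 * s)))

  partition-ℕ : ∀ x → χ (x <ᵇ m) + χ (flip x <ᵇ m) + χ (not (x <ᵇ m + m)) ≡ 1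
  partition-ℕ x with place x
  ... | low p rewrite flip-low p | <ᵇ⁺ p | <ᵇ-false (m≤m+n m x) | <ᵇ⁺ (≤-trans p (m≤m+n m m)) = refl
  ... | mid p q r rewrite flip-mid p q | <ᵇ-false p | <ᵇ⁺ r | <ᵇ⁺ q = refl
  ... | high p rewrite flip-high p | <ᵇ-false (≤-trans (m≤m+n m m) p) | <ᵇ-false p = refl

  partition : ∀ v → χ (below m v) + χ (below m (π v)) + (χ (Y₀ v) + χ (P v)) ≡ 1
  partition v = trans (cong₂ (λ a b → χ (below m v) + χ (a <ᵇ m) + b) (toℕ-π v) (merge (below-mm⊆ v))) (partition-ℕ (toℕ v))
    where
    merge : ∀ {a b} → (b ≡ true → a ≡ true) → χ (not a) + χ (a ∧ not b) ≡ χ (not b)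
    merge {true} {b} h = refl
    merge {false} {true} h with () ← h refl
    merge {false} {false} h = refl

  size-X≡ : size {n} (below m) ≡ m
  size-X≡ = size-below m (≤-trans (m≤m+n m m) mm≤n)

  size-Y₀≡ : size Y₀ ≡ y
  size-Y₀≡ = +-cancelˡ-≡ q _ _ (begin
    q + size Y₀ ≡⟨ cong (_+ size Y₀) (sym (size-below q q≤n)) ⟩
    size {n} (below q) + size Y₀ ≡⟨ sym (size-∖ {n} {below q} {λ _ → true} (λ v _ → refl)) ⟩
    size {n} (λ _ → true) ≡⟨ trans (size-full n) n≡ ⟩
    q + y ∎)
    where open ≡-Reasoning

  size-P≡ : size P ≡ 10 * s
  size-P≡ = +-cancelˡ-≡ (m + m) _ _ (begin
    m + m + size P ≡⟨ cong (_+ size P) (sym (size-below (m + m) mm≤n)) ⟩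
    size {n} (below (m + m)) + size P ≡⟨ sym (size-∖ {n} {below (m + m)} {below q} below-mm⊆) ⟩
    size {n} (below q) ≡⟨ size-below q q≤n ⟩
    m + m + 10 * s ∎)
    where open ≡-Reasoning

  layout : Layout n s
  layout = record
    { X = below m ; Y₀ = Y₀ ; P = P ; π = π
    ; π-involutive = λ v → toℕ-injective (trans (toℕ-π (π v)) (trans (cong flip (toℕ-π v)) (flip-involutive (toℕ v))))
    ; partition = partition
    ; size-X = ≤-trans (m≤n+m (4 * s) y) (≤-reflexive (sym (trans size-X≡ m≡)))
    ; size-Y₀ = ≤-trans 4s≤y (≤-reflexive (sym size-Y₀≡))
    ; size-P = size-P≡
    ; balance = trans (cong₂ _+_ size-Y₀≡ size-P≡) (trans (arrange y s) (cong (_+ 6 * s) (sym (trans size-X≡ m≡))))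
    }
    where
    arrange : ∀ y s → y + 10 * s ≡ y + 4 * s + 6 * s
    arrange = solve-∀

-- Exponential decay without fractions

-- These are the first two terms of the binomial expansion on the right.
bernoulli : ∀ m R d → R ^ suc m + suc m * d * R ^ m ≤ (R + d) ^ suc m
bernoulli zero R d = ≤-reflexive (arrange R d)
  where
  arrange : ∀ R d → R * 1 + (d + 0) * 1 ≡ (R + d) * 1
  arrange = solve-∀
bernoulli (suc m) R d = begin
  R * (R * p) + (d + (d + m * d)) * (R * p) ≤⟨ m≤m+n _ (d * ((d + m * d) * p)) ⟩
  R * (R * p) + (d + (d + m * d)) * (R * p) + d * ((d + m * d) * p) ≡⟨ arrange R d m p ⟩
  (R + d) * (R * p + (d + m * d) * p) ≤⟨ *-monoʳ-≤ (R + d) (bernoulli m R d) ⟩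
  (R + d) ^ suc (suc m) ∎
  where
  open ≤-Reasoning
  p = R ^ m
  arrange : ∀ R d m p → R * (R * p) + (d + (d + m * d)) * (R * p) + d * ((d + m * d) * p) ≡ (R + d) * (R * p + (d + m * d) * p)
  arrange = solve-∀

-- If `R ≤ M * d`, the second of these terms is at least the first: `M` rounds halve a failure
-- probability R/(R + d) per round.
doubling : ∀ M .{{_ : NonZero M}} R d → R ≤ M * d → R ^ M * 2 ≤ (R + d) ^ M
doubling (suc m) R d R≤ = begin
  R ^ suc m * 2 ≡⟨ arrange (R ^ suc m) ⟩
  R ^ suc m + R * R ^ m ≤⟨ +-monoʳ-≤ (R ^ suc m) (*-monoˡ-≤ (R ^ m) R≤) ⟩
  R ^ suc m + suc m * d * R ^ m ≤⟨ bernoulli m R d ⟩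
  (R + d) ^ suc m ∎
  where
  open ≤-Reasoning
  arrange : ∀ x → x * 2 ≡ x + x
  arrange = solve-∀

-- These are `2 * n` halvings. Half of them will absorb a factor `2 ^ n`, the other half makes
-- failure rare.
decay : ∀ M .{{_ : NonZero M}} R d n → R ≤ M * d → R ^ (M * 2 * n) * 4 ^ n ≤ (R + d) ^ (M * 2 * n)
decay M R d n R≤ = begin
  R ^ (M * 2 * n) * 4 ^ n ≡⟨ cong₂ _*_ (exponent R) (^-*-assoc 2 2 n) ⟩
  (R ^ M) ^ (2 * n) * 2 ^ (2 * n) ≡⟨ sym (^-distribʳ-* (2 * n) (R ^ M) 2) ⟩
  (R ^ M * 2) ^ (2 * n) ≤⟨ ^-monoˡ-≤ (2 * n) (doubling M R d R≤) ⟩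
  ((R + d) ^ M) ^ (2 * n) ≡⟨ sym (exponent (R + d)) ⟩
  (R + d) ^ (M * 2 * n) ∎
  where
  open ≤-Reasoning
  exponent : ∀ b → b ^ (M * 2 * n) ≡ (b ^ M) ^ (2 * n)
  exponent b = trans (cong (b ^_) (*-assoc M 2 n)) (sym (^-*-assoc b M (2 * n)))

n<2^n : ∀ n → n < 2 ^ n
n<2^n zero = s≤s z≤n
n<2^n (suc n) = ≤-trans (s≤s (n<2^n n)) (≤-trans (+-monoˡ-≤ (2 ^ n) (m^n>0 2 n)) (≤-reflexive (cong (2 ^ n +_) (sym (+-identityʳ (2 ^ n))))))

-- The failure probability

count-offers : ∀ n → length (allOffers n) * 2 + n ≡ n * n
count-offers n = trans (cong₂ (λ a b → a * 2 + b) (sym (ΣL-length (allOffers n))) (sym (size-full n)))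
  (trans (count-within {n} (λ _ → true)) (cong₂ _*_ (size-full n) (size-full n)))

module Success {n s : ℕ} (L : Layout n s) (0<s : 0 < s) where
  open Layout L using (X)
  open Play L 0<s
  open Random X Y s
  open Cover {n}

  planned-cases : ∀ acc → (∃ λ (p : Plan acc) → planned acc ≡ (Plan.targets p , Plan.pool p)) ⊎
                          (planned acc ≡ ([] , ∅) × separators acc ≢ 0)
  planned-cases acc with separators acc ≟ 0
  ... | yes none = inj₁ (makePlan acc none , refl)
  ... | no some = inj₂ (refl , some)

  success : ∀ {T₁ T₂} (os : Vec (Offer n) T₁) (os′ : Vec (Offer n) T₂) → separators (toList os) ≡ 0 →
    unfinished (planned (toList os)) (toList os′) ≡ false → HasPerfectMatching (hypergraph (strategy T₁) (os Vec.++ os′))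
  success {T₁} os os′ none fin with planned-cases (toList os)
  ... | inj₂ (_ , some) = contradiction none some
  ... | inj₁ (p , e) = subst HasPerfectMatching
    (sym (trans (play≡run T₁ [] (os Vec.++ os′)) (trans (run-first [] os os′)
      (cong (λ st → map firstEdge (toList os) ++ run (second st) os′) e))))
    (perfectMatching (toList os) none p os′ (trans (sym (cong (λ st → unfinished st (toList os′)) e)) fin))

  fails : ∀ {T₁ T₂} → Vec (Offer n) T₁ → Vec (Offer n) T₂ → Bool
  fails os os′ = not (does (separators (toList os) ≟ 0)) ∨ unfinished (planned (toList os)) (toList os′)

  module _ (R : ℕ) (4N≡ : length (allOffers n) * 4 ≡ R + s * s) (3s≤n : 3 * s ≤ n) (T : ℕ) where

    private
      N = length (allOffers n)
      Ω = seqs (allOffers n) T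

    -- There are at most `3 * s ≤ n` targets, so the initial potential is at most `2 ^ n`, the same
    -- factor as in the union bound.
    second-bound : ∀ acc → ΣL Ω (λ os → χ (unfinished (planned acc) (toList os))) * 4 ^ T ≤ 2 ^ n * R ^ T
    second-bound acc with planned-cases acc
    ... | inj₁ (p , e) = begin
      ΣL Ω (λ os → χ (unfinished (planned acc) (toList os))) * 4 ^ T
        ≡⟨ cong (λ st → ΣL Ω (λ os → χ (unfinished st (toList os))) * 4 ^ T) e ⟩
      ΣL Ω (λ os → χ (unfinished (targets , pool) (toList os))) * 4 ^ T
        ≤⟨ unfinished-bound s R 4N≡ T targets pool room ⟩
      2 ^ length targets * R ^ T ≤⟨ *-monoˡ-≤ (R ^ T) (^-monoʳ-≤ 2 (≤-trans targets-few 3s≤n)) ⟩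
      2 ^ n * R ^ T ∎
      where
      open ≤-Reasoning
      open Plan p
    ... | inj₂ (e , _) = ≤-trans (≤-reflexive (trans (cong (λ st → ΣL Ω (λ os → χ (unfinished st (toList os))) * 4 ^ T) e)
      (cong (_* 4 ^ T) (trans (ΣL-const Ω 0) (*-zeroʳ (length Ω)))))) z≤n

    -- First moments: a non-zero number of separators is at least one, so the two phases contribute
    -- one expectation each, both at most 2^n (R/(4N))^T.
    fails-bound : ΣL (seqs (allOffers n) (T + T)) (λ os → χ (fails (take T os) (drop T os))) * (4 ^ T * 4 ^ T)
      ≤ 2 * (2 ^ n * R ^ T * (N * 4) ^ T)
    fails-bound = begin
      ΣL (seqs (allOffers n) (T + T)) (λ os → χ (fails (take T os) (drop T os))) * (f * f)
        ≡⟨ cong (_* (f * f)) (ΣL-seqs-split (allOffers n) T λ a b → χ (fails a b)) ⟩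
      ΣL Ω (λ a → ΣL Ω (λ b → χ (fails a b))) * (f * f)
        ≤⟨ *-monoˡ-≤ (f * f) (ΣL-mono Ω λ a → ΣL-mono Ω λ b → either a b) ⟩
      ΣL Ω (λ a → ΣL Ω (λ b → bad a + late a b)) * (f * f)
        ≡⟨ cong (_* (f * f)) (ΣL-cong Ω λ a → trans (ΣL-+ Ω (λ _ → bad a) (late a)) (cong (_+ ΣL Ω (late a)) (trans (ΣL-const Ω (bad a)) (*-comm (length Ω) (bad a))))) ⟩
      ΣL Ω (λ a → bad a * length Ω + ΣL Ω (late a)) * (f * f)
        ≡⟨ cong (_* (f * f)) (trans (ΣL-+ Ω _ _) (cong (_+ Late) (sym (ΣL-*ʳ Ω bad (length Ω))))) ⟩
      (ΣL Ω bad * length Ω + Late) * (f * f) ≡⟨ arrange₁ (ΣL Ω bad) (length Ω) Late f ⟩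
      ΣL Ω bad * f * (length Ω * f) + Late * f * f
        ≤⟨ +-mono-≤ (*-monoˡ-≤ (length Ω * f) (separators-bound disjoint R 4N≡ T)) (*-monoˡ-≤ f lates) ⟩
      E * (length Ω * f) + length Ω * E * f ≡⟨ arrange₂ E (length Ω) f ⟩
      2 * (E * (length Ω * f))
        ≡⟨ cong (λ l → 2 * (E * l)) (trans (cong (_* f) (length-seqs (allOffers n) T)) (sym (^-distribʳ-* T N 4))) ⟩
      2 * (E * (N * 4) ^ T) ∎
      where
      open ≤-Reasoning
      f = 4 ^ T
      E = 2 ^ n * R ^ T
      bad : Vec (Offer n) T → ℕ
      bad a = separators (toList a)
      late : Vec (Offer n) T → Vec (Offer n) T → ℕ
      late a b = χ (unfinished (planned (toList a)) (toList b))
      Late = ΣL Ω (λ a → ΣL Ω (late a))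
      positive : ∀ k → χ (not (does (k ≟ 0))) ≤ k
      positive zero = z≤n
      positive (suc k) = s≤s z≤n
      either : ∀ a b → χ (fails a b) ≤ bad a + late a b
      either a b = ≤-trans (χ-∨≤ (not (does (bad a ≟ 0))) _) (+-monoˡ-≤ (late a b) (positive (bad a)))
      lates : Late * f ≤ length Ω * E
      lates = ≤-trans (≤-reflexive (ΣL-*ʳ Ω (λ a → ΣL Ω (late a)) f)) (ΣL-bound Ω _ E λ a → second-bound (toList a))
      arrange₁ : ∀ a l b f → (a * l + b) * (f * f) ≡ a * f * (l * f) + b * f * f
      arrange₁ = solve-∀
      arrange₂ : ∀ E l f → E * (l * f) + l * E * f ≡ 2 * (E * (l * f))
      arrange₂ = solve-∀

  module _ (K : ℕ) .{{_ : NonZero (2 * (K * K))}} (2≤n : 2 ≤ n) (3s≤n : 3 * s ≤ n) (n≤Ks : n ≤ K * s) where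

    private
      N = length (allOffers n)
      -- This gives `R ≤ M * (s * s)`: `R` is at most 4N, which is at most 2n², and `n ≤ K * s`.
      M = 2 * (K * K)
      T = M * 2 * n
      R = N * 4 ∸ s * s

      2n²≡ : N * 4 + 2 * n ≡ 2 * (n * n)
      2n²≡ = trans (arrange N n) (cong (2 *_) (count-offers n))
        where
        arrange : ∀ N n → N * 4 + 2 * n ≡ 2 * (N * 2 + n)
        arrange = solve-∀

      s²≤4N : s * s ≤ N * 4
      s²≤4N = ≤-trans (*-mono-≤ s≤n s≤n) (+-cancelʳ-≤ (n * n) _ _ (begin
        n * n + n * n ≡⟨ cong (n * n +_) (sym (+-identityʳ (n * n))) ⟩
        2 * (n * n) ≡⟨ sym 2n²≡ ⟩
        N * 4 + 2 * n ≤⟨ +-monoʳ-≤ (N * 4) (*-monoˡ-≤ n 2≤n) ⟩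
        N * 4 + n * n ∎))
        where
        open ≤-Reasoning
        s≤n : s ≤ n
        s≤n = ≤-trans (m≤m+n s (s + (s + 0))) 3s≤n

      4N≡ : N * 4 ≡ R + s * s
      4N≡ = sym (m∸n+n≡m s²≤4N)

      R≤ : R ≤ M * (s * s)
      R≤ = begin
        R ≤⟨ m∸n≤m (N * 4) (s * s) ⟩
        N * 4 ≤⟨ m≤m+n (N * 4) (2 * n) ⟩
        N * 4 + 2 * n ≡⟨ 2n²≡ ⟩
        2 * (n * n) ≤⟨ *-monoʳ-≤ 2 (*-mono-≤ n≤Ks n≤Ks) ⟩
        2 * (K * s * (K * s)) ≡⟨ arrange K s ⟩
        M * (s * s) ∎
        where
        open ≤-Reasoning
        arrange : ∀ K s → 2 * (K * s * (K * s)) ≡ 2 * (K * K) * (s * s)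
        arrange = solve-∀

      all-seqs = seqs (allOffers n) (T + T)
      failed succeeded : ℕ
      failed = ΣL all-seqs (λ os → χ (fails (take T os) (drop T os)))
      succeeds? : ∀ os → Dec (fails (take T os) (drop T os) ≡ false)
      succeeds? os = fails (take T os) (drop T os) Boolₚ.≟ false
      succeeded = length (filter succeeds? all-seqs)

      total : succeeded + failed ≡ N ^ (T + T)
      total = begin
        succeeded + failed ≡⟨ cong (_+ failed) (length-filter succeeds? all-seqs) ⟩
        ΣL all-seqs (χ ∘ does ∘ succeeds?) + failed ≡⟨ sym (ΣL-+ all-seqs _ _) ⟩
        ΣL all-seqs (λ os → χ (does (succeeds? os)) + χ (fails (take T os) (drop T os)))
          ≡⟨ ΣL-cong all-seqs (λ os → one (fails (take T os) (drop T os))) ⟩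
        ΣL all-seqs (λ _ → 1) ≡⟨ trans (ΣL-length all-seqs) (length-seqs (allOffers n) (T + T)) ⟩
        N ^ (T + T) ∎
        where
        open ≡-Reasoning
        one : ∀ b → χ (does (b Boolₚ.≟ false)) + χ b ≡ 1
        one true = refl
        one false = refl

      -- By `decay`, (R/(4N))^T is at most 4^(-n); the factor 2^n of each phase leaves 2^(-n).
      rare : failed * 2 ^ n ≤ 2 * N ^ (T + T)
      rare = *-cancelʳ-≤ _ _ (4 ^ T * 4 ^ T * 2 ^ n) {{nonZero}} (begin
        failed * 2 ^ n * (4 ^ T * 4 ^ T * 2 ^ n) ≡⟨ arrange₁ failed (2 ^ n) (4 ^ T * 4 ^ T) ⟩
        failed * (4 ^ T * 4 ^ T) * (2 ^ n * 2 ^ n) ≤⟨ *-monoˡ-≤ (2 ^ n * 2 ^ n) (fails-bound R 4N≡ 3s≤n T) ⟩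
        2 * (2 ^ n * R ^ T * F) * (2 ^ n * 2 ^ n) ≡⟨ arrange₂ (2 ^ n) (R ^ T) F ⟩
        2 * (R ^ T * (2 ^ n * 2 ^ n)) * F * 2 ^ n
          ≡⟨ cong (λ k → 2 * (R ^ T * k) * F * 2 ^ n) (sym (^-distribʳ-* n 2 2)) ⟩
        2 * (R ^ T * 4 ^ n) * F * 2 ^ n ≤⟨ *-monoˡ-≤ (2 ^ n) (*-monoˡ-≤ F (*-monoʳ-≤ 2 (decay M R (s * s) n R≤))) ⟩
        2 * (R + s * s) ^ T * F * 2 ^ n ≡⟨ cong (λ k → 2 * k ^ T * F * 2 ^ n) (sym 4N≡) ⟩
        2 * F * F * 2 ^ n ≡⟨ cong (λ k → 2 * k * k * 2 ^ n) (^-distribʳ-* T N 4) ⟩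
        2 * (N ^ T * 4 ^ T) * (N ^ T * 4 ^ T) * 2 ^ n ≡⟨ arrange₃ (N ^ T) (4 ^ T) (2 ^ n) ⟩
        2 * (N ^ T * N ^ T) * (4 ^ T * 4 ^ T * 2 ^ n)
          ≡⟨ cong (λ k → 2 * k * (4 ^ T * 4 ^ T * 2 ^ n)) (sym (^-distribˡ-+-* N T T)) ⟩
        2 * N ^ (T + T) * (4 ^ T * 4 ^ T * 2 ^ n) ∎)
        where
        open ≤-Reasoning
        F = (N * 4) ^ T
        nonZero : NonZero (4 ^ T * 4 ^ T * 2 ^ n)
        nonZero = m*n≢0 (4 ^ T * 4 ^ T) (2 ^ n) {{m*n≢0 (4 ^ T) (4 ^ T) {{m^n≢0 4 T}} {{m^n≢0 4 T}}}} {{m^n≢0 2 n}}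
        arrange₁ : ∀ a b c → a * b * (c * b) ≡ a * c * (b * b)
        arrange₁ = solve-∀
        arrange₂ : ∀ a b c → 2 * (a * b * c) * (a * a) ≡ 2 * (b * (a * a)) * c * a
        arrange₂ = solve-∀
        arrange₃ : ∀ a b c → 2 * (a * b) * (a * b) * c ≡ 2 * (a * a) * (b * b * c)
        arrange₃ = solve-∀

    -- The probability of failure is at most 2/2^n, and `2 * suc k ≤ 2 ^ n`; so success has
    -- probability at least k/(k + 1).
    likely : ∀ k → suc k < n → ∃ λ g → AtLeastGood n (T + T) (strategy T) g × k * totalSequences n (T + T) ≤ suc k * g
    likely k k<n = succeeded ,
      (filter succeeds? all-seqs ,
       Uniqueₚ.filter⁺ succeeds? (unique-seqs (allOffers n) (unique-allOffers n) (T + T)) ,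
       All.map (λ {os} → good os) (Allₚ.all-filter succeeds? all-seqs) ,
       ≤-refl) ,
      subst (λ t → k * t ^ (T + T) ≤ suc k * succeeded) (length-allOffers n)
        (+-cancelʳ-≤ (suc k * failed) _ _ (begin
          k * N ^ (T + T) + suc k * failed ≤⟨ +-monoʳ-≤ (k * N ^ (T + T)) few ⟩
          k * N ^ (T + T) + N ^ (T + T) ≡⟨ +-comm (k * N ^ (T + T)) _ ⟩
          suc k * N ^ (T + T) ≡⟨ cong (suc k *_) (sym total) ⟩
          suc k * (succeeded + failed) ≡⟨ *-distribˡ-+ (suc k) succeeded failed ⟩
          suc k * succeeded + suc k * failed ∎))
      where
      open ≤-Reasoning
      few : suc k * failed ≤ N ^ (T + T)
      few = *-cancelˡ-≤ 2 (begin
        2 * (suc k * failed) ≡⟨ arrange (suc k) failed ⟩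
        failed * (2 * suc k) ≤⟨ *-monoʳ-≤ failed (≤-trans (*-monoʳ-≤ 2 (<⇒≤ (n<2^n (suc k)))) (^-monoʳ-≤ 2 k<n)) ⟩
        failed * 2 ^ n ≤⟨ rare ⟩
        2 * N ^ (T + T) ∎)
        where
        arrange : ∀ a b → 2 * (a * b) ≡ b * (2 * a)
        arrange = solve-∀
      ∨-false : ∀ {a b} → a ∨ b ≡ false → a ≡ false × b ≡ false
      ∨-false {false} {false} h = refl , refl
      zero-test : ∀ {k} → not (does (k ≟ 0)) ≡ false → k ≡ 0
      zero-test {zero} h = refl
      good : ∀ os → fails (take T os) (drop T os) ≡ false → HasPerfectMatching (hypergraph (strategy T) os)
      good os h = subst (HasPerfectMatching ∘ hypergraph (strategy T)) (take++drop≡id T os)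
        (success (take T os) (drop T os) (zero-test (proj₁ (∨-false h))) (proj₂ (∨-false {not (does (separators (toList (take T os)) ≟ 0))} h)))

-- Choice of the parameters

record Parameters (n : ℕ) : Set where
  field
    s : ℕ
    0<s : 0 < s
    layout : Layout n s
    3s≤n : 3 * s ≤ n
    n≤96s : n ≤ 96 * s

-- For n = 3p, the equations n = 2m + 10s + y and m = y + 4s force m = p - 2s. Dividing `p` by `16`
-- leaves `10 * s ≤ p`, as `4 * s ≤ y` requires. From `48 ≤ n` comes `0 < s`, so p < 16 + 16s ≤ 32s
-- and `n ≤ 96 * s`.
parameters : ∀ n → 48 ≤ n → 3 ∣ n → Parameters n
parameters n 48≤n (divides p n≡p*3) = record
  { s = s ; 0<s = 0<s ; layout = Concrete.layout {n} {m} {s} {y} n≡ (sym (m∸n+n≡m 4s≤m)) (+-cancelʳ-≤ (4 * s) _ _ 8s≤)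
  ; 3s≤n = ≤-trans (*-monoʳ-≤ 3 (≤-trans (m≤m+n s _) 16s≤p)) (≤-reflexive (trans (*-comm 3 p) (sym n≡p*3)))
  ; n≤96s = n≤96s }
  where
  s = p / 16
  m = p ∸ 2 * s
  y = m ∸ 4 * s
  p≡ : p ≡ p % 16 + s * 16
  p≡ = m≡m%n+[m/n]*n p 16
  16s≤p : 16 * s ≤ p
  16s≤p = ≤-trans (≤-reflexive (*-comm 16 s)) (≤-trans (m≤n+m (s * 16) (p % 16)) (≤-reflexive (sym p≡)))
  p<16+ : p < 16 + 16 * s
  p<16+ = ≤-trans (s≤s (≤-reflexive p≡)) (+-mono-≤ (m%n<n p 16) (≤-reflexive (*-comm s 16)))
  16≤p : 16 ≤ p
  16≤p = *-cancelʳ-≤ 16 p 3 (≤-trans 48≤n (≤-reflexive n≡p*3))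
  0<s : 0 < s
  0<s = n≢0⇒n>0 λ e → <⇒≱ p<16+ (≤-trans (≤-reflexive (cong (λ k → 16 + 16 * k) e)) 16≤p)
  p≡m+2s : m + 2 * s ≡ p
  p≡m+2s = m∸n+n≡m (≤-trans (*-monoˡ-≤ s (m≤m+n 2 14)) 16s≤p)
  8s≤m : 8 * s ≤ m
  8s≤m = +-cancelʳ-≤ (2 * s) _ _ (≤-trans (≤-reflexive (arrange s)) (≤-trans (*-monoˡ-≤ s (m≤m+n 10 6)) (≤-trans 16s≤p (≤-reflexive (sym p≡m+2s)))))
    where
    arrange : ∀ s → 8 * s + 2 * s ≡ 10 * s
    arrange = solve-∀
  4s≤m : 4 * s ≤ m
  4s≤m = ≤-trans (*-monoˡ-≤ s (m≤m+n 4 4)) 8s≤m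
  8s≤ : 4 * s + 4 * s ≤ y + 4 * s
  8s≤ = ≤-trans (≤-reflexive (arrange s)) (≤-trans 8s≤m (≤-reflexive (sym (m∸n+n≡m 4s≤m))))
    where
    arrange : ∀ s → 4 * s + 4 * s ≡ 8 * s
    arrange = solve-∀
  n≡ : n ≡ m + m + 10 * s + y
  n≡ = begin
    n ≡⟨ n≡p*3 ⟩
    p * 3 ≡⟨ cong (_* 3) (sym p≡m+2s) ⟩
    (m + 2 * s) * 3 ≡⟨ arrange₁ m s ⟩
    m + m + 6 * s + m ≡⟨ cong (m + m + 6 * s +_) (sym (m∸n+n≡m 4s≤m)) ⟩
    m + m + 6 * s + (y + 4 * s) ≡⟨ arrange₂ (m + m) s y ⟩
    m + m + 10 * s + y ∎
    where
    open ≡-Reasoning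
    arrange₁ : ∀ m s → (m + 2 * s) * 3 ≡ m + m + 6 * s + m
    arrange₁ = solve-∀
    arrange₂ : ∀ k s y → k + 6 * s + (y + 4 * s) ≡ k + 10 * s + y
    arrange₂ = solve-∀
  n≤96s : n ≤ 96 * s
  n≤96s = begin
    n ≡⟨ n≡p*3 ⟩
    p * 3 ≤⟨ *-monoˡ-≤ 3 (<⇒≤ p<16+) ⟩
    (16 + 16 * s) * 3 ≤⟨ *-monoˡ-≤ 3 (+-monoˡ-≤ (16 * s) (*-monoʳ-≤ 16 0<s)) ⟩
    (16 * s + 16 * s) * 3 ≡⟨ arrange s ⟩
    96 * s ∎
    where
    open ≤-Reasoning
    arrange : ∀ s → (16 * s + 16 * s) * 3 ≡ 96 * s
    arrange = solve-∀

-- `K` stays a variable, so that the large constant is not computed with.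
module Main (K : ℕ) (K≡ : K ≡ 96) where

  c : ℕ
  -- This is `M * 2` with `M = 2 * (K * K)`: each of the two phases lasts `c * n` rounds.
  c = 2 * (K * K) * 2

  chosen : ∀ n → Strategy n
  chosen n with 48 ≤? n | 3 ∣? n
  ... | yes 48≤n | yes 3∣n = let open Parameters (parameters n 48≤n 3∣n) in Play.strategy layout 0<s (c * n)
  ... | _ | _ = λ _ o → proj₁ (proj₁ o)

  main : ∀ k n → 48 + k ≤ n → 3 ∣ n →
    ∃ λ g → AtLeastGood n ((c + c) * n) (chosen n) g × k * totalSequences n ((c + c) * n) ≤ suc k * g
  main k n large 3∣n with 48 ≤? n | 3 ∣? n
  ... | no small | _ = contradiction (≤-trans (m≤m+n 48 k) large) small
  ... | yes _ | no ∤ = contradiction 3∣n ∤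
  ... | yes 48≤n | yes 3∣n′ = subst
    (λ t → ∃ λ g → AtLeastGood n t (Play.strategy layout 0<s (c * n)) g × k * totalSequences n t ≤ suc k * g)
    (sym (*-distribʳ-+ n c c))
    (Success.likely layout 0<s K {{nz}} (≤-trans (m≤m+n 2 46) 48≤n) 3s≤n (subst (λ K → n ≤ K * s) (sym K≡) n≤96s) k
      (≤-trans (+-monoˡ-≤ k (m≤m+n 2 46)) large))
    where
    open Parameters (parameters n 48≤n 3∣n′)
    nz : NonZero (2 * (K * K))
    nz = subst (λ K → NonZero (2 * (K * K))) (sym K≡) _

theorem1 : ∃ λ (C : ℕ) → Σ ((n : ℕ) → Strategy n) λ σ →
    ∀ (k : ℕ) → ∃ λ (N : ℕ) → ∀ (n : ℕ) → N ≤ n → 3 ∣ n →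
    ∃ λ (g : ℕ) → AtLeastGood n (C * n) (σ n) g
    × k * totalSequences n (C * n) ≤ suc k * g
theorem1 = c + c , chosen , λ k → 48 + k , main k
  where open Main 96 refl
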